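{- Let $p$ be a positive integer and let $(G,\sigma)$ be a signed graph (with a fixed orientation $\tau$) whose underlying graph $G$ is odd-$(2p+1)$-edge-connected. Then $(G,\sigma)$ admits a modulo circular $(2+\frac{1}{p})$-flow if and only if it admits an integer-valued circular $(2+\frac{1}{p})$-flow.
   Context: Graphs may have multiple edges and loops. An edge set $F$ is an odd-$\lambda$-edge cut if $|F|=\lambda$ is odd and $G-F$ has more components than $G$; $G$ is odd-$\lambda$-edge-connected if it contains no odd-$k$-edge cut for any $k\le\lambda-2$. A signed graph $(G,\sigma)$ is a graph $G$ with a signature $\sigma\colon E(G)\to\{\pm1\}$. Each edge consists of two half-edges, each incident with exactly one end of the edge; $H(v)$ denotes the set of half-edges incident with $v$, $H(G)=\bigcup_v H(v)$, and $e_h$ is the edge containing half-edge $h$. An orientation of $(G,\sigma)$ is a map $\tau\colon H(G)\to\{\pm1\}$ with $\tau(h_1)\tau(h_2)=-\sigma(e)$ for every edge $e$ with half-edges $h_1,h_2$. For $f\colon E(G)\to\mathbb{Z}$, the boundary at $v$ is $\partial f(v)=\sum_{h\in H(v)} f(e_h)\tau(h)$. For positive integers $k,d$, an integer-valued (resp. modulo) circular $\frac{k}{d}$-flow is a map $f\colon E(G)\to\mathbb{Z}$ with $d\le |f(e)|\le k-d$ for every edge $e$ and $\partial f(v)=0$ (resp. $\partial f(v)\equiv 0\pmod k$) for every vertex $v$. Here $2+\frac1p=\frac{2p+1}{p}$, so a circular $(2+\frac1p)$-flow has $p\le|f(e)|\le p+1$ and the modulus is $2p+1$. -}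

module Defs where

open import Data.Nat as ℕ using (ℕ; zero; suc; _≤_; _<_)
open import Data.Nat.Properties using ()
open import Data.Integer as ℤ using (ℤ; +_; ∣_∣)
open import Data.Integer.Divisibility using () renaming (_∣_ to _∣ℤ_)
open import Data.Fin using (Fin; zero; suc; _≟_)
import Data.Fin
open import Data.Bool using (Bool; true; false; _∧_; _∨_; not; if_then_else_)
open import Data.Sign as Sign using (Sign)
open import Data.Product using (_×_; _,_; proj₁; proj₂; ∃)
open import Relation.Nullary.Decidable using (⌊_⌋)
open import Relation.Binary.PropositionalEquality using (_≡_)
open import Relation.Nullary using (¬_)

-- Finite graphs with multiple edges and loops.
-- Vertices Fin n, edges Fin m; edge e has ends (ends e) = (u , v).
-- The half-edge (e , false) is incident with proj₁ (ends e),
-- the half-edge (e , true) is incident with proj₂ (ends e).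

record Graph : Set where
  field
    n    : ℕ
    m    : ℕ
    ends : Fin m → Fin n × Fin n
open Graph public

HalfEdge : Graph → Set
HalfEdge G = Fin (m G) × Bool

endOf : (G : Graph) → HalfEdge G → Fin (n G)
endOf G (e , false) = proj₁ (ends G e)
endOf G (e , true)  = proj₂ (ends G e)

ΣFin : ∀ {k} → (Fin k → ℤ) → ℤ
ΣFin {zero}  f = + 0
ΣFin {suc k} f = f zero ℤ.+ ΣFin (λ i → f (suc i))

count : ∀ {k} → (Fin k → Bool) → ℕ
count {zero}  P = 0
count {suc k} P = (if P zero then 1 else 0) ℕ.+ count (λ i → P (suc i))

anyFin : ∀ {k} → (Fin k → Bool) → Bool
anyFin {zero}  P = false
anyFin {suc k} P = P zero ∨ anyFin (λ i → P (suc i))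

_==_ : ∀ {k} → Fin k → Fin k → Bool
i == j = ⌊ i ≟ j ⌋

reachWithin : (G : Graph) → (Fin (m G) → Bool) → ℕ → Fin (n G) → Fin (n G) → Bool
reachWithin G present zero    u v = u == v
reachWithin G present (suc k) u v =
  reachWithin G present k u v ∨
  anyFin (λ e → present e ∧
     ((reachWithin G present k u (proj₁ (ends G e)) ∧ (proj₂ (ends G e) == v)) ∨
      (reachWithin G present k u (proj₂ (ends G e)) ∧ (proj₁ (ends G e) == v))))

connected : (G : Graph) → (Fin (m G) → Bool) → Fin (n G) → Fin (n G) → Bool
connected G present u v = reachWithin G present (n G) u v

_<ᵇ_ : ∀ {k} → Fin k → Fin k → Bool
i <ᵇ j = ⌊ Data.Fin._<?_ i j ⌋

-- number of components: count the vertices that are the least vertex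
-- of their component
components : (G : Graph) → (Fin (m G) → Bool) → ℕ
components G present =
  count (λ v → not (anyFin (λ w → (w <ᵇ v) ∧ connected G present w v)))

allEdges : (G : Graph) → Fin (m G) → Bool
allEdges G _ = true

numComponentsMinus : (G : Graph) → (Fin (m G) → Bool) → ℕ
numComponentsMinus G F = components G (λ e → not (F e))

Odd : ℕ → Set
Odd k = ∃ λ j → k ≡ 2 ℕ.* j ℕ.+ 1

IsOddEdgeCut : (G : Graph) → ℕ → (Fin (m G) → Bool) → Set
IsOddEdgeCut G λ' F =
  count F ≡ λ' × Odd λ' × components G (allEdges G) < numComponentsMinus G F

OddEdgeConnected : Graph → ℕ → Set
OddEdgeConnected G λ' =
  ∀ (k : ℕ) → k ℕ.+ 2 ≤ λ' → ∀ (F : Fin (m G) → Bool) → ¬ IsOddEdgeCut G k F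

Signature : Graph → Set
Signature G = Fin (m G) → Sign

Orientation : Graph → Set
Orientation G = HalfEdge G → Sign

IsOrientation : (G : Graph) → Signature G → Orientation G → Set
IsOrientation G σ τ =
  ∀ e → τ (e , false) Sign.* τ (e , true) ≡ Sign.opposite (σ e)

signℤ : Sign → ℤ
signℤ Sign.+ = + 1
signℤ Sign.- = ℤ.- (+ 1)

-- ∂f(v) = Σ_{h ∈ H(v)} f(e_h) τ(h); a loop contributes both half-edges
boundary : (G : Graph) → Orientation G → (Fin (m G) → ℤ) → Fin (n G) → ℤ
boundary G τ f v = ΣFin (λ e →
  (if endOf G (e , false) == v then f e ℤ.* signℤ (τ (e , false)) else + 0) ℤ.+
  (if endOf G (e , true)  == v then f e ℤ.* signℤ (τ (e , true))  else + 0))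

IntegerCircularFlow : (G : Graph) → Orientation G → (k d : ℕ) → (Fin (m G) → ℤ) → Set
IntegerCircularFlow G τ k d f =
  (∀ e → d ≤ ∣ f e ∣ × ∣ f e ∣ ≤ k ℕ.∸ d) × (∀ v → boundary G τ f v ≡ + 0)

ModuloCircularFlow : (G : Graph) → Orientation G → (k d : ℕ) → (Fin (m G) → ℤ) → Set
ModuloCircularFlow G τ k d f =
  (∀ e → d ≤ ∣ f e ∣ × ∣ f e ∣ ≤ k ℕ.∸ d) × (∀ v → (+ k) ∣ℤ boundary G τ f v)

-- circular (2 + 1/p)-flows: k = 2p+1, d = p
AdmitsIntegerFlow : (G : Graph) → Signature G → Orientation G → ℕ → Set
AdmitsIntegerFlow G σ τ p = ∃ λ f → IntegerCircularFlow G τ (2 ℕ.* p ℕ.+ 1) p f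

AdmitsModuloFlow : (G : Graph) → Signature G → Orientation G → ℕ → Set
AdmitsModuloFlow G σ τ p = ∃ λ f → ModuloCircularFlow G τ (2 ℕ.* p ℕ.+ 1) p f

{-# OPTIONS --safe #-}
-- Flipping an edge of a modulo (2 + 1/p)-flow f, i.e. replacing f(e) by f(e) ∓ (2p+1), gives another modulo flow and
-- moves the imbalance ∂f / (2p+1) by ±1 at each end of e.  So we look for a set of flips that minimises the total
-- deviation of the imbalances from a target, and show that for target 0 the minimum is 0, by an argument in the style
-- of Gallai's proof of the Tutte-Berge formula.  As long as some vertex deviates in at most one direction over all
-- optimal states, moving its target the other way raises the minimum by one.  In the end every vertex either has a
-- target beyond all attainable imbalances ("far"), or deviates in both directions in suitable optimal states.  Adjacent
-- vertices of the latter kind never deviate simultaneously in an optimal state, and this relation is transitive, so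
-- each of its classes K carries a total deviation of at most 1.  In an optimal state of least far cost all edges
-- between K and the far vertices point the same way.  If K deviates and its targets are 0, then the weight of δ(K) is
-- odd by parity, hence at least 2p+1 unless K is bounded by a bridge, which the connectivity excludes.  Summing ∂f
-- over the far vertices then contradicts a positive original minimum.

module Submission where

open import Defs
open import Data.Nat using (ℕ; _≤_; _+_; _*_)
open import Function.Bundles using (_⇔_)

open import Algebra.Bundles using (CommutativeMonoid)
open import Data.Nat as ℕ using (zero; suc)
import Data.Nat.Properties as ℕ
import Data.Nat.Divisibility as ℕ
import Data.Nat.Tactic.RingSolver as ℕ-Solver
open import Data.Integer as ℤ using (ℤ; +_; -[1+_]; ∣_∣; +≤+; -≤+; +<+; -<-; -<+)
import Data.Integer.Properties as ℤ
open import Data.Integer.Divisibility.Signed using (divides; ∣ᵤ⇒∣)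
open import Data.Integer.Tactic.RingSolver using (solve-∀)
open import Data.Fin as Fin using (Fin; zero; suc; _≟_; toℕ)
import Data.Fin.Properties as Fin
open import Data.Fin.Properties using (any?)
open import Data.Fin.Subset.Properties using (anySubset?)
open import Data.Bool using (Bool; true; false; not; if_then_else_; _xor_; _∧_; _∨_)
import Data.Bool.Properties as Bool
open import Data.Sign as Sign using (Sign; opposite)
import Data.Sign.Properties as Sign
open import Data.Vec using (Vec; lookup; updateAt; replicate)
open import Data.Vec.Properties using (lookup∘updateAt; lookup∘updateAt′; lookup-replicate)
open import Data.Product using (_×_; _,_; proj₁; proj₂; ∃; ∃₂)
open import Data.Sum using (_⊎_; inj₁; inj₂; [_,_]′)
open import Data.Empty using (⊥)
open import Function using (_∘_)
open import Function.Bundles using (mk⇔)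
open import Relation.Binary.Definitions using (tri<; tri≈; tri>)
open import Relation.Nullary using (¬_; Dec; yes; no; contradiction)
open import Relation.Nullary.Decidable using (_×-dec_; ¬?; decidable-stable; ⌊_⌋)
open import Relation.Binary.PropositionalEquality hiding (setoid)
open import Algebra.Properties.Semiring.Sum ℕ.+-*-semiring as Σℕ using () renaming (sum to sumℕ)
open import Algebra.Properties.Semiring.Sum ℤ.+-*-semiring as Σℤ using () renaming (sum to sumℤ)

-- Directions and signs of integers

infix 4 _⟶[_]_
-- Carrying the direction as a `Sign` lets one argument cover positive and negative deviations.
-- Strictness leaves zero without a sign in `HasSign`.
_⟶[_]_ : ℤ → Sign → ℤ → Set
a ⟶[ Sign.+ ] b = a ℤ.< b
a ⟶[ Sign.- ] b = b ℤ.< a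

HasSign : Sign → ℤ → Set
HasSign ε z = + 0 ⟶[ ε ] z

⟶-dec : ∀ ε a b → Dec (a ⟶[ ε ] b)
⟶-dec Sign.+ a b = a ℤ.<? b
⟶-dec Sign.- a b = b ℤ.<? a

hasSign? : ∀ ε z → Dec (HasSign ε z)
hasSign? ε z = ⟶-dec ε (+ 0) z

⟶-trans : ∀ ε {a b c} → a ⟶[ ε ] b → b ⟶[ ε ] c → a ⟶[ ε ] c
⟶-trans Sign.+ p q = ℤ.<-trans p q
⟶-trans Sign.- p q = ℤ.<-trans q p

⟶-flip : ∀ ε {a b} → a ⟶[ opposite ε ] b → b ⟶[ ε ] a
⟶-flip Sign.+ p = p
⟶-flip Sign.- p = p

<⇒<1+ : ∀ {a b} → a ℤ.≤ b → a ℤ.< b ℤ.+ + 1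
<⇒<1+ {a} {b} p = ℤ.≤-<-trans p (subst (ℤ._< b ℤ.+ + 1) (ℤ.+-identityʳ b) (ℤ.+-monoʳ-< b (+<+ (ℕ.s≤s ℕ.z≤n))))

-1<⇐≤ : ∀ {a b} → a ℤ.≤ b → a ℤ.+ -[1+ 0 ] ℤ.< b
-1<⇐≤ {a} {b} p = ℤ.<-≤-trans (subst (a ℤ.+ -[1+ 0 ] ℤ.<_) (ℤ.+-identityʳ a) (ℤ.+-monoʳ-< a -<+)) p

-- Over the integers, a unit step from a point at or beyond `t` lands strictly beyond it. Trails use
-- this to turn back at a vertex pushed too far.
overshoot : ∀ ε {z t} → ¬ (z ⟶[ ε ] t) → z ℤ.+ signℤ ε ⟶[ opposite ε ] t
overshoot Sign.+ ¬p = <⇒<1+ (ℤ.≮⇒≥ ¬p)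
overshoot Sign.- ¬p = -1<⇐≤ (ℤ.≮⇒≥ ¬p)

step-in : ∀ ε z → HasSign (opposite ε) z → ∣ z ∣ ≡ suc ∣ z ℤ.+ signℤ ε ∣
step-in Sign.+ -[1+ zero ] p = refl
step-in Sign.+ -[1+ suc n ] p = refl
step-in Sign.+ (+ n) (+<+ ())
step-in Sign.- (+ suc n) p = refl
step-in Sign.- (+ zero) (+<+ ())

step-out : ∀ ε z → ¬ HasSign (opposite ε) z → ∣ z ℤ.+ signℤ ε ∣ ≡ suc ∣ z ∣
step-out Sign.+ (+ n) p = ℕ.+-comm n 1
step-out Sign.+ -[1+ n ] p = contradiction -<+ p
step-out Sign.- (+ zero) p = refl
step-out Sign.- (+ suc n) p = contradiction (+<+ (ℕ.s≤s ℕ.z≤n)) p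
step-out Sign.- -[1+ n ] p = cong (ℕ.suc ∘ ℕ.suc) (ℕ.+-identityʳ n)

step-out-sign : ∀ ε z → ¬ HasSign (opposite ε) z → HasSign ε (z ℤ.+ signℤ ε)
step-out-sign Sign.+ z p = <⇒<1+ (ℤ.≮⇒≥ p)
step-out-sign Sign.- z p = -1<⇐≤ (ℤ.≮⇒≥ p)

sign-unique : ∀ ε ζ {z} → HasSign ε z → HasSign ζ z → ε ≡ ζ
sign-unique Sign.+ Sign.+ p q = refl
sign-unique Sign.+ Sign.- p q = contradiction q (ℤ.<-asym p)
sign-unique Sign.- Sign.+ p q = contradiction q (ℤ.<-asym p)
sign-unique Sign.- Sign.- p q = refl

sign-unique-opp : ∀ ε ζ {z} → HasSign ζ z → ¬ HasSign (opposite ε) z → ζ ≡ ε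
sign-unique-opp Sign.+ Sign.+ p q = refl
sign-unique-opp Sign.+ Sign.- p q = contradiction p q
sign-unique-opp Sign.- Sign.+ p q = contradiction p q
sign-unique-opp Sign.- Sign.- p q = refl

sign-of : ∀ z → ∣ z ∣ ≢ 0 → ∃ λ ε → HasSign ε z
sign-of (+ zero) p = contradiction refl p
sign-of (+ suc n) p = Sign.+ , +<+ (ℕ.s≤s ℕ.z≤n)
sign-of -[1+ n ] p = Sign.- , -<+

signed⇒≢0 : ∀ ε {z} → HasSign ε z → ∣ z ∣ ≢ 0
signed⇒≢0 Sign.+ {+ zero} (+<+ ()) q
signed⇒≢0 Sign.- {+ zero} (+<+ ()) q

signed-abs : ∀ ε {z} → HasSign ε z → z ≡ signℤ ε ℤ.* + ∣ z ∣
signed-abs Sign.+ {+ n} p = sym (ℤ.*-identityˡ (+ n))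
signed-abs Sign.- { -[1+ n ]} p = cong -[1+_] (sym (ℕ.+-identityʳ n))
signed-abs Sign.- {+ n} (+<+ ())

-- The direction leads from `a` to zero. As `b` is smaller in size, it lies strictly on that side,
-- so moving `a` towards `b` begins by reducing `∣ a ∣`.
larger-abs : ∀ a b → ∣ b ∣ ℕ.< ∣ a ∣ → ∃ λ ε → HasSign (opposite ε) a × a ⟶[ ε ] b
larger-abs (+ suc n) (+ k) p = Sign.- , +<+ (ℕ.s≤s ℕ.z≤n) , +<+ p
larger-abs (+ suc n) -[1+ k ] p = Sign.- , +<+ (ℕ.s≤s ℕ.z≤n) , -<+
larger-abs -[1+ n ] (+ k) p = Sign.+ , -<+ , -<+
larger-abs -[1+ n ] -[1+ k ] (ℕ.s≤s p) = Sign.+ , -<+ , -<- p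

away-not-toward : ∀ ε z t → ¬ HasSign (opposite ε) z → z ⟶[ ε ] t → ∣ z ∣ ℕ.< ∣ t ∣
away-not-toward Sign.+ (+ n) (+ k) p (+<+ q) = q
away-not-toward Sign.+ -[1+ n ] t p q = contradiction -<+ p
away-not-toward Sign.- (+ suc n) t p q = contradiction (+<+ (ℕ.s≤s ℕ.z≤n)) p
away-not-toward Sign.- (+ zero) -[1+ k ] p q = ℕ.s≤s ℕ.z≤n
away-not-toward Sign.- (+ zero) (+ k) p (+<+ ())
away-not-toward Sign.- -[1+ n ] -[1+ k ] p (-<- q) = ℕ.s≤s q

-- Signed unit vectors and finite sums

single : ∀ {n} → Fin n → Sign → Fin n → ℤ
single s ε v with s ≟ v
... | yes _ = signℤ ε
... | no  _ = + 0

single-self : ∀ {n} (s : Fin n) ε → single s ε s ≡ signℤ ε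
single-self s ε with s ≟ s
... | yes _ = refl
... | no ¬p = contradiction refl ¬p

single-other : ∀ {n} {s v : Fin n} ε → s ≢ v → single s ε v ≡ + 0
single-other {s = s} {v} ε s≢v with s ≟ v
... | yes p = contradiction p s≢v
... | no _ = refl

single-opposite : ∀ {n} (s : Fin n) ε v → single s (opposite ε) v ≡ ℤ.- single s ε v
single-opposite s ε v with s ≟ v | ε
... | yes _ | Sign.+ = refl
... | yes _ | Sign.- = refl
... | no _  | _ = refl

sumℕ-mono : ∀ {n} {f g : Fin n → ℕ} → (∀ i → f i ℕ.≤ g i) → sumℕ f ℕ.≤ sumℕ g
sumℕ-mono {zero} p = ℕ.z≤n
sumℕ-mono {suc n} p = ℕ.+-mono-≤ (p zero) (sumℕ-mono (p ∘ suc))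

-- Strictness in one term would make the totals strict. Domination between states of equal cost thus
-- becomes equality at every vertex.
sumℕ-tight : ∀ {n} {f g : Fin n → ℕ} → (∀ i → f i ℕ.≤ g i) → sumℕ g ℕ.≤ sumℕ f → ∀ i → g i ℕ.≤ f i
sumℕ-tight {suc n} {f} {g} p q zero = ℕ.+-cancelʳ-≤ (sumℕ (f ∘ suc)) (g zero) (f zero)
  (ℕ.≤-trans (ℕ.+-monoʳ-≤ (g zero) (sumℕ-mono (p ∘ suc))) q)
sumℕ-tight {suc n} {f} {g} p q (suc i) = sumℕ-tight (p ∘ suc)
  (ℕ.+-cancelˡ-≤ (f zero) _ _ (ℕ.≤-trans (ℕ.+-monoˡ-≤ (sumℕ (g ∘ suc)) (p zero)) q)) i

module _ {c ℓ} (M : CommutativeMonoid c ℓ) where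
  open CommutativeMonoid M renaming (_∙_ to _+′_; ∙-cong to +-cong′; comm to +-comm′; assoc to +-assoc′; refl to ≈-refl; sym to ≈-sym)
  open import Algebra.Properties.CommutativeMonoid.Sum M using (sum)
  open import Relation.Binary.Reasoning.Setoid (CommutativeMonoid.setoid M)

  private
    sum-cong : ∀ {n} {f g : Fin n → Carrier} → (∀ i → f i ≈ g i) → sum f ≈ sum g
    sum-cong {zero} p = ≈-refl
    sum-cong {suc n} p = +-cong′ (p zero) (sum-cong (p ∘ suc))

  -- The terms at `s` are crossed over instead of subtracted, so that one identity serves sums in
  -- `ℕ` and in `ℤ`.
  sum-change : ∀ {n} (f g : Fin n → Carrier) s → (∀ i → s ≢ i → f i ≈ g i) → sum f +′ g s ≈ sum g +′ f s
  sum-change {suc n} f g zero p = begin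
    (f zero +′ sum (f ∘ suc)) +′ g zero ≈⟨ +-cong′ (+-cong′ ≈-refl (sum-cong (λ i → p (suc i) (λ ())))) ≈-refl ⟩
    (f zero +′ sum (g ∘ suc)) +′ g zero ≈⟨ +-comm′ _ _ ⟩
    g zero +′ (f zero +′ sum (g ∘ suc)) ≈⟨ +-cong′ ≈-refl (+-comm′ _ _) ⟩
    g zero +′ (sum (g ∘ suc) +′ f zero) ≈⟨ +-assoc′ _ _ _ ⟨
    (g zero +′ sum (g ∘ suc)) +′ f zero ∎
  sum-change {suc n} f g (suc s) p = begin
    (f zero +′ sum (f ∘ suc)) +′ g (suc s) ≈⟨ +-assoc′ _ _ _ ⟩
    f zero +′ (sum (f ∘ suc) +′ g (suc s)) ≈⟨ +-cong′ (p zero (λ ())) (sum-change (f ∘ suc) (g ∘ suc) s (λ i q → p (suc i) (λ { refl → q refl }))) ⟩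
    g zero +′ (sum (g ∘ suc) +′ f (suc s)) ≈⟨ +-assoc′ _ _ _ ⟨
    (g zero +′ sum (g ∘ suc)) +′ f (suc s) ∎

sumℤ-mono : ∀ {n} {f g : Fin n → ℤ} → (∀ i → f i ℤ.≤ g i) → sumℤ f ℤ.≤ sumℤ g
sumℤ-mono {zero} p = ℤ.≤-refl
sumℤ-mono {suc n} p = ℤ.+-mono-≤ (p zero) (sumℤ-mono (p ∘ suc))

sumℤ-<⇒∃ : ∀ {n} (f g : Fin n → ℤ) → sumℤ f ℤ.< sumℤ g → ∃ λ i → f i ℤ.< g i
sumℤ-<⇒∃ {zero} f g (+<+ ())
sumℤ-<⇒∃ {suc n} f g p with f zero ℤ.<? g zero
... | yes q = zero , q
... | no ¬q with sumℤ-<⇒∃ (f ∘ suc) (g ∘ suc)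
      (ℤ.≰⇒> λ r → ℤ.<⇒≱ p (ℤ.+-mono-≤ (ℤ.≮⇒≥ ¬q) r))
...   | i , r = suc i , r

sumℤ-⟶⇒∃ : ∀ {n} ε (f g : Fin n → ℤ) → sumℤ f ⟶[ ε ] sumℤ g → ∃ λ i → f i ⟶[ ε ] g i
sumℤ-⟶⇒∃ Sign.+ f g p = sumℤ-<⇒∃ f g p
sumℤ-⟶⇒∃ Sign.- f g p = sumℤ-<⇒∃ g f p

+-sum : ∀ {n} (f : Fin n → ℕ) → + sumℕ f ≡ sumℤ (λ i → + f i)
+-sum {zero} f = refl
+-sum {suc n} f = cong (ℤ._+_ (+ f zero)) (+-sum (f ∘ suc))

ΣFin≡sumℤ : ∀ {n} (f : Fin n → ℤ) → ΣFin f ≡ sumℤ f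
ΣFin≡sumℤ {zero} f = refl
ΣFin≡sumℤ {suc n} f = cong (ℤ._+_ (f zero)) (ΣFin≡sumℤ (f ∘ suc))

sumℤ-single : ∀ {n} (g : Fin n → ℤ) s ε → sumℤ (λ v → g v ℤ.* single s ε v) ≡ g s ℤ.* signℤ ε
sumℤ-single {suc n} g zero ε = begin
  g zero ℤ.* signℤ ε ℤ.+ sumℤ (λ i → g (suc i) ℤ.* single zero ε (suc i))
    ≡⟨ cong (ℤ._+_ (g zero ℤ.* signℤ ε)) (trans (Σℤ.sum-cong-≗ (λ i → ℤ.*-zeroʳ (g (suc i)))) (Σℤ.sum-replicate-zero n)) ⟩
  g zero ℤ.* signℤ ε ℤ.+ + 0 ≡⟨ ℤ.+-identityʳ _ ⟩
  g zero ℤ.* signℤ ε ∎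
  where open ≡-Reasoning
sumℤ-single {suc n} g (suc s) ε = begin
  g zero ℤ.* + 0 ℤ.+ sumℤ (λ i → g (suc i) ℤ.* single (suc s) ε (suc i))
    ≡⟨ cong₂ ℤ._+_ (ℤ.*-zeroʳ (g zero)) (Σℤ.sum-cong-≗ (λ i → cong (g (suc i) ℤ.*_) (single-suc s ε i))) ⟩
  + 0 ℤ.+ sumℤ (λ i → g (suc i) ℤ.* single s ε i) ≡⟨ ℤ.+-identityˡ _ ⟩
  sumℤ (λ i → g (suc i) ℤ.* single s ε i) ≡⟨ sumℤ-single (g ∘ suc) s ε ⟩
  g (suc s) ℤ.* signℤ ε ∎
  where
  open ≡-Reasoning
  single-suc : ∀ {n} (s : Fin n) ε i → single (suc s) ε (suc i) ≡ single s ε i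
  single-suc s ε i with s ≟ i
  ... | yes _ = refl
  ... | no _ = refl

-- Cost of a vector under unit changes

cost : ∀ {n} → (Fin n → ℤ) → ℕ
cost z = sumℕ (λ v → ∣ z v ∣)

cost-cong : ∀ {n} {y z : Fin n → ℤ} → (∀ v → y v ≡ z v) → cost y ≡ cost z
cost-cong p = Σℕ.sum-cong-≗ (λ v → cong ∣_∣ (p v))

module _ {n} (z : Fin n → ℤ) (s : Fin n) (ε : Sign) where

  bump : Fin n → ℤ
  bump v = z v ℤ.+ single s ε v

  bump-self : bump s ≡ z s ℤ.+ signℤ ε
  bump-self = cong (ℤ._+_ (z s)) (single-self s ε)

  bump-other : ∀ {v} → s ≢ v → bump v ≡ z v
  bump-other {v} p = trans (cong (ℤ._+_ (z v)) (single-other ε p)) (ℤ.+-identityʳ (z v))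

  private
    change : cost bump ℕ.+ ∣ z s ∣ ≡ cost z ℕ.+ ∣ z s ℤ.+ signℤ ε ∣
    change = trans (sum-change ℕ.+-0-commutativeMonoid (λ v → ∣ bump v ∣) (λ v → ∣ z v ∣) s (λ v p → cong ∣_∣ (bump-other p)))
                   (cong (λ t → cost z ℕ.+ ∣ t ∣) bump-self)

  -- Together with `cost-bump-out` this leaves no neutral move: each unit change alters the cost by
  -- exactly one. Both the parity invariant and the exchange argument rest on this.
  cost-bump-in : HasSign (opposite ε) (z s) → cost z ≡ suc (cost bump)
  cost-bump-in p = ℕ.+-cancelʳ-≡ ∣ z s ℤ.+ signℤ ε ∣ (cost z) (suc (cost bump)) (begin
    cost z ℕ.+ ∣ z s ℤ.+ signℤ ε ∣ ≡⟨ change ⟨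
    cost bump ℕ.+ ∣ z s ∣ ≡⟨ cong (cost bump ℕ.+_) (step-in ε (z s) p) ⟩
    cost bump ℕ.+ suc ∣ z s ℤ.+ signℤ ε ∣ ≡⟨ ℕ.+-suc _ _ ⟩
    suc (cost bump) ℕ.+ ∣ z s ℤ.+ signℤ ε ∣ ∎)
    where open ≡-Reasoning

  cost-bump-out : ¬ HasSign (opposite ε) (z s) → cost bump ≡ suc (cost z)
  cost-bump-out p = ℕ.+-cancelʳ-≡ ∣ z s ∣ (cost bump) (suc (cost z)) (begin
    cost bump ℕ.+ ∣ z s ∣ ≡⟨ change ⟩
    cost z ℕ.+ ∣ z s ℤ.+ signℤ ε ∣ ≡⟨ cong (cost z ℕ.+_) (step-out ε (z s) p) ⟩
    cost z ℕ.+ suc ∣ z s ∣ ≡⟨ ℕ.+-suc _ _ ⟩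
    suc (cost z) ℕ.+ ∣ z s ∣ ∎)
    where open ≡-Reasoning

  cost-bump-≤ : cost bump ℕ.≤ suc (cost z)
  cost-bump-≤ with hasSign? (opposite ε) (z s)
  ... | yes p = ℕ.≤-trans (ℕ.≤-trans (ℕ.n≤1+n _) (ℕ.≤-reflexive (sym (cost-bump-in p)))) (ℕ.n≤1+n _)
  ... | no ¬p = ℕ.≤-reflexive (cost-bump-out ¬p)

signed-one : ∀ ε ζ → HasSign ε (signℤ ζ) → ζ ≡ ε
signed-one Sign.+ Sign.+ p = refl
signed-one Sign.- Sign.- p = refl
signed-one Sign.- Sign.+ (+<+ ())

-- The delicate case is a loop, with both half-edges at `s`: opposite signs cancel, so a nonzero sum
-- has the common sign.
singles-sign : ∀ {n} (u w s : Fin n) ε₁ ε₂ ε → HasSign ε (single u ε₁ s ℤ.+ single w ε₂ s) →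
  (u ≡ s × ε₁ ≡ ε) ⊎ (w ≡ s × ε₂ ≡ ε)
singles-sign u w s ε₁ ε₂ ε p with u ≟ s | w ≟ s
... | no _ | no _ = contradiction refl (signed⇒≢0 ε p)
... | yes q | no _ = inj₁ (q , signed-one ε ε₁ (subst (HasSign ε) (ℤ.+-identityʳ _) p))
... | no _ | yes q = inj₂ (q , signed-one ε ε₂ (subst (HasSign ε) (ℤ.+-identityˡ _) p))
... | yes q | yes r = pick ε ε₁ ε₂ p
  where
  pick : ∀ ε ε₁ ε₂ → HasSign ε (signℤ ε₁ ℤ.+ signℤ ε₂) → (u ≡ s × ε₁ ≡ ε) ⊎ (w ≡ s × ε₂ ≡ ε)
  pick Sign.+ Sign.+ _ _ = inj₁ (q , refl)
  pick Sign.+ Sign.- Sign.+ _ = inj₂ (r , refl)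
  pick Sign.+ Sign.- Sign.- ()
  pick Sign.- Sign.- _ _ = inj₁ (q , refl)
  pick Sign.- Sign.+ Sign.- _ = inj₂ (r , refl)
  pick Sign.- Sign.+ Sign.+ (+<+ ())

-- Alternating trails

-- A state marks the edges that are flipped relative to the initial modulo (2 + 1/p)-flow f₀, where flipping e replaces
-- f₀ e by f₀ e ∓ (2p+1).  With c v = ∂f₀(v) / (2p+1), δ c x v is ∂f(v) / (2p+1) for the flow f belonging to x.
-- out e h is the sign with which ∣ f₀ e ∣ enters the boundary at half-edge h.
module Bidirected {n m : ℕ} (end : Fin m → Bool → Fin n) (out : Fin m → Bool → Sign) where

  State : Set
  State = Vec Bool m

  flip : State → Fin m → State
  flip x e = updateAt x e not

  cur : State → Fin m → Bool → Sign
  cur x e h = if lookup x e then opposite (out e h) else out e h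

  -- A flip changes f(e) by 2p+1 against its current sign, so each half-edge changes the imbalance
  -- at its end by minus its current sign.
  step : State → Fin m → Fin n → ℤ
  step x e v = single (end e false) (opposite (cur x e false)) v ℤ.+ single (end e true) (opposite (cur x e true)) v

  κ : Bool → Fin m → Fin n → ℤ
  κ false e v = + 0
  κ true  e v = single (end e false) (opposite (out e false)) v ℤ.+ single (end e true) (opposite (out e true)) v

  δ : (Fin n → ℤ) → State → Fin n → ℤ
  δ c x v = c v ℤ.+ sumℤ (λ e → κ (lookup x e) e v)

  κ-flip : ∀ x e v → κ (not (lookup x e)) e v ≡ κ (lookup x e) e v ℤ.+ step x e v
  κ-flip x e v with lookup x e
  ... | false = sym (ℤ.+-identityˡ _)
  ... | true = sym (trans (cong₂ (λ a b → κ true e v ℤ.+ (a ℤ.+ b)) (double e false) (double e true))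
    (ring-lemma (single (end e false) (opposite (out e false)) v) (single (end e true) (opposite (out e true)) v)))
    where
    double : ∀ e h → single (end e h) (opposite (opposite (out e h))) v ≡ ℤ.- single (end e h) (opposite (out e h)) v
    double e h = single-opposite (end e h) (opposite (out e h)) v
    ring-lemma : ∀ a b → a ℤ.+ b ℤ.+ (ℤ.- a ℤ.+ ℤ.- b) ≡ + 0
    ring-lemma = solve-∀

  δ-flip : ∀ c x e v → δ c (flip x e) v ≡ δ c x v ℤ.+ step x e v
  δ-flip c x e v = trans (cong (ℤ._+_ (c v)) sum-flip) (sym (ℤ.+-assoc (c v) _ _))
    where
    K K′ : Fin m → ℤ
    K i = κ (lookup x i) i v
    K′ i = κ (lookup (flip x e) i) i v
    K′e : K′ e ≡ K e ℤ.+ step x e v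
    K′e = trans (cong (λ b → κ b e v) (lookup∘updateAt e x)) (κ-flip x e v)
    ring-lemma : ∀ a b d → a ℤ.+ (b ℤ.+ d) ℤ.+ (ℤ.- b) ≡ a ℤ.+ d
    ring-lemma = solve-∀
    ring-lemma₂ : ∀ a b → a ≡ a ℤ.+ b ℤ.+ ℤ.- b
    ring-lemma₂ = solve-∀
    sum-flip : sumℤ K′ ≡ sumℤ K ℤ.+ step x e v
    sum-flip = begin
      sumℤ K′ ≡⟨ ring-lemma₂ (sumℤ K′) (K e) ⟩
      sumℤ K′ ℤ.+ K e ℤ.+ ℤ.- K e
        ≡⟨ cong (ℤ._+ ℤ.- K e) (sum-change ℤ.+-0-commutativeMonoid K′ K e
             (λ i e≢i → cong (λ b → κ b i v) (lookup∘updateAt′ i e (e≢i ∘ sym) x))) ⟩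
      sumℤ K ℤ.+ K′ e ℤ.+ ℤ.- K e ≡⟨ cong (λ t → sumℤ K ℤ.+ t ℤ.+ ℤ.- K e) K′e ⟩
      sumℤ K ℤ.+ (K e ℤ.+ step x e v) ℤ.+ ℤ.- K e ≡⟨ ring-lemma (sumℤ K) (K e) _ ⟩
      sumℤ K ℤ.+ step x e v ∎
      where open ≡-Reasoning

  differ : Bool → Bool → ℕ
  differ a b = if a xor b then 1 else 0

  dist : State → State → ℕ
  dist x y = sumℕ (λ e → differ (lookup x e) (lookup y e))

  dist-flip : ∀ y x e → lookup y e ≢ lookup x e → dist y x ≡ suc (dist (flip y e) x)
  dist-flip y x e p = ℕ.+-cancelʳ-≡ 0 _ _ (begin
      dist y x ℕ.+ 0 ≡⟨ cong (dist y x ℕ.+_) dif₀ ⟨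
      dist y x ℕ.+ differ (lookup (flip y e) e) (lookup x e)
        ≡⟨ sum-change ℕ.+-0-commutativeMonoid (λ i → differ (lookup y i) (lookup x i)) (λ i → differ (lookup (flip y e) i) (lookup x i)) e
             (λ i e≢i → cong (λ b → differ b (lookup x i)) (sym (lookup∘updateAt′ i e (e≢i ∘ sym) y))) ⟩
      dist (flip y e) x ℕ.+ differ (lookup y e) (lookup x e) ≡⟨ cong (dist (flip y e) x ℕ.+_) (dif₁ (lookup y e) (lookup x e) p) ⟩
      dist (flip y e) x ℕ.+ 1 ≡⟨ ℕ.+-comm _ 1 ⟩
      suc (dist (flip y e) x) ≡⟨ ℕ.+-identityʳ _ ⟨
      suc (dist (flip y e) x) ℕ.+ 0 ∎)
    where
    open ≡-Reasoning
    dif₁ : ∀ a b → a ≢ b → differ a b ≡ 1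
    dif₁ false false q = contradiction refl q
    dif₁ false true q = refl
    dif₁ true false q = refl
    dif₁ true true q = contradiction refl q
    dif₂ : ∀ a b → a ≢ b → differ (not a) b ≡ 0
    dif₂ false false q = contradiction refl q
    dif₂ false true q = refl
    dif₂ true false q = refl
    dif₂ true true q = contradiction refl q
    dif₀ : differ (lookup (flip y e) e) (lookup x e) ≡ 0
    dif₀ = trans (cong (λ b → differ b (lookup x e)) (lookup∘updateAt e y)) (dif₂ (lookup y e) (lookup x e) p)

  flip-closer : ∀ y x e → lookup y e ≢ lookup x e → dist (flip y e) x ℕ.< dist y x
  flip-closer y x e p = ℕ.≤-reflexive (sym (dist-flip y x e p))

  +-cancel-⟶ : ∀ ε c {a b} → c ℤ.+ a ⟶[ ε ] c ℤ.+ b → a ⟶[ ε ] b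
  +-cancel-⟶ Sign.+ c {a} {b} p = subst₂ ℤ._<_ (cancel c a) (cancel c b) (ℤ.+-monoʳ-< (ℤ.- c) p)
    where cancel : ∀ c a → ℤ.- c ℤ.+ (c ℤ.+ a) ≡ a
          cancel = solve-∀
  +-cancel-⟶ Sign.- c {a} {b} p = +-cancel-⟶ Sign.+ c p

  -- Both imbalances are `c s` plus a sum over edges, so some term differs strictly in direction
  -- `ε`. The states disagree on its edge, and flipping that edge in `y` contributes exactly the
  -- difference.
  half-edge-toward : ∀ c y x s ε → δ c y s ⟶[ ε ] δ c x s →
    ∃₂ λ e h → lookup y e ≢ lookup x e × end e h ≡ s × opposite (cur y e h) ≡ ε
  half-edge-toward c y x s ε p with sumℤ-⟶⇒∃ ε (λ e → κ (lookup y e) e s) (λ e → κ (lookup x e) e s) (+-cancel-⟶ ε (c s) p)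
  ... | e , q = e , half (moves q)
    where
    y≢x : lookup y e ≢ lookup x e
    y≢x eq = irrefl ε (subst (λ b → κ (lookup y e) e s ⟶[ ε ] κ b e s) (sym eq) q)
      where irrefl : ∀ ε {a} → ¬ (a ⟶[ ε ] a)
            irrefl Sign.+ r = ℤ.<-irrefl refl r
            irrefl Sign.- r = ℤ.<-irrefl refl r
    moves : κ (lookup y e) e s ⟶[ ε ] κ (lookup x e) e s → HasSign ε (step y e s)
    moves q = +-cancel-⟶ ε (κ (lookup y e) e s)
      (subst₂ (_⟶[ ε ]_) (sym (ℤ.+-identityʳ _))
         (trans (cong (λ b → κ b e s) (Bool.¬-not (y≢x ∘ sym))) (κ-flip y e s)) q)
    half : HasSign ε (step y e s) → ∃ λ h → lookup y e ≢ lookup x e × end e h ≡ s × opposite (cur y e h) ≡ ε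
    half r with singles-sign (end e false) (end e true) s (opposite (cur y e false)) (opposite (cur y e true)) ε r
    ... | inj₁ (u≡s , eq) = false , y≢x , u≡s , eq
    ... | inj₂ (w≡s , eq) = true , y≢x , w≡s , eq

  step-from : ∀ x e h v → step x e v ≡ single (end e h) (opposite (cur x e h)) v ℤ.+ single (end e (not h)) (opposite (cur x e (not h))) v
  step-from x e false v = refl
  step-from x e true v = ℤ.+-comm (single (end e false) _ v) _

  -- Contributions at the inner vertices of a trail cancel, so only its two ends are affected. By
  -- `towards`, the final move also goes in the direction of the value in `x`.
  record Trail (c : Fin n → ℤ) (y x : State) (s : Fin n) (ε : Sign) : Set where
    field
      target  : State
      stop    : Fin n
      dir     : Sign
      closer  : dist target x ℕ.< dist y x
      effect  : ∀ v → δ c target v ≡ bump (bump (δ c y) s ε) stop dir v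
      towards : bump (δ c y) s ε stop ⟶[ dir ] δ c x stop

  abstract
    -- If the far end of the flipped edge is pushed away from its value in x, the trail continues from there.
    trail : ∀ c d y x s ε → dist y x ℕ.≤ d → δ c y s ⟶[ ε ] δ c x s → Trail c y x s ε
    trail c d y x s ε bound p with half-edge-toward c y x s ε p
    ... | e , h , differs , refl , refl = go d bound (⟶-dec η (z w) (δ c x w))
      where
      w : Fin n
      w = end e (not h)
      η : Sign
      η = opposite (cur y e (not h))
      z : Fin n → ℤ
      z = bump (δ c y) s ε
      y₁ : State
      y₁ = flip y e

      closer₁ : dist y₁ x ℕ.< dist y x
      closer₁ = flip-closer y x e differs

      effect₁ : ∀ v → δ c y₁ v ≡ bump z w η v
      effect₁ v = trans (δ-flip c y e v) (trans (cong (ℤ._+_ (δ c y v)) (step-from y e h v)) (sym (ℤ.+-assoc (δ c y v) _ _)))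

      bump-cancel : ∀ v → bump (bump z w η) w (opposite η) v ≡ z v
      bump-cancel v = trans (cong (ℤ._+_ (bump z w η v)) (single-opposite w η v)) (cancel (z v) (single w η v))
        where cancel : ∀ a b → a ℤ.+ b ℤ.+ ℤ.- b ≡ a
              cancel = solve-∀

      -- Each flip corrects an edge on which the states differ, so the distance to `x` bounds the
      -- length of the trail.
      go : ∀ d → dist y x ℕ.≤ d → Dec (z w ⟶[ η ] δ c x w) → Trail c y x s ε
      go _ _ (yes q) = record { target = y₁ ; stop = w ; dir = η ; closer = closer₁ ; effect = effect₁ ; towards = q }
      go zero b (no _) = contradiction (ℕ.<-≤-trans closer₁ b) λ ()
      go (suc d) b (no ¬q) = record
        { target = target ; stop = stop ; dir = dir
        ; closer = ℕ.<-trans closer closer₁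
        ; effect = λ v → trans (effect v) (cong (ℤ._+ single stop dir v) (undo v))
        ; towards = subst (_⟶[ dir ] δ c x stop) (undo stop) towards
        }
        where
        undo : ∀ v → bump (δ c y₁) w (opposite η) v ≡ z v
        undo v = trans (cong (ℤ._+ single w (opposite η) v) (effect₁ v)) (bump-cancel v)
        -- The push carried `w` strictly beyond its value in `x`, so the trail continues in the
        -- reverse direction, and its next move undoes the push.
        start : δ c y₁ w ⟶[ opposite η ] δ c x w
        start = subst (_⟶[ opposite η ] δ c x w) (sym (trans (effect₁ w) (bump-self z w η))) (overshoot η ¬q)
        rest : Trail c y₁ x w (opposite η)
        rest = trail c d y₁ x w (opposite η) (ℕ.≤-pred (ℕ.<-≤-trans closer₁ b)) start
        open Trail {c} {y₁} {x} {w} {opposite η} rest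

  differing-edge : ∀ y x → dist y x ≢ 0 → ∃ λ e → lookup y e ≢ lookup x e
  differing-edge y x p = find (λ e → lookup y e) (λ e → lookup x e) p
    where
    find : ∀ {m} (f g : Fin m → Bool) → sumℕ (λ e → differ (f e) (g e)) ≢ 0 → ∃ λ e → f e ≢ g e
    find {zero} f g p = contradiction refl p
    find {suc m} f g p with f zero Bool.≟ g zero
    ... | no q = zero , q
    ... | yes q with find (f ∘ suc) (g ∘ suc) (λ r → p (cong₂ ℕ._+_ (trans (cong (differ (f zero)) (sym q)) (same (f zero))) r))
      where same : ∀ b → differ b b ≡ 0
            same false = refl
            same true = refl
    ...   | e , r = suc e , r

  -- Parity of the cost

  parity : ℕ → Bool
  parity zero = false
  parity (suc k) = not (parity k)

  cost-bump-parity : ∀ (z : Fin n → ℤ) s ε → parity (cost (bump z s ε)) ≡ not (parity (cost z))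
  cost-bump-parity z s ε with hasSign? (opposite ε) (z s)
  ... | yes p = trans (sym (Bool.not-involutive _)) (cong not (cong parity (sym (cost-bump-in z s ε p))))
  ... | no ¬p = cong parity (cost-bump-out z s ε ¬p)

  δ-flip-bump : ∀ c x e v → δ c (flip x e) v ≡ bump (bump (δ c x) (end e false) (opposite (cur x e false))) (end e true) (opposite (cur x e true)) v
  δ-flip-bump c x e v = trans (δ-flip c x e v) (sym (ℤ.+-assoc (δ c x v) _ _))

  -- A flip consists of two unit changes, one per half-edge, also for a loop; each reverses the
  -- parity.
  flip-parity : ∀ c x e → parity (cost (δ c (flip x e))) ≡ parity (cost (δ c x))
  flip-parity c x e = begin
    parity (cost (δ c (flip x e))) ≡⟨ cong parity (cost-cong (δ-flip-bump c x e)) ⟩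
    parity (cost (bump z w η)) ≡⟨ cost-bump-parity z w η ⟩
    not (parity (cost z)) ≡⟨ cong not (cost-bump-parity (δ c x) u ε) ⟩
    not (not (parity (cost (δ c x)))) ≡⟨ Bool.not-involutive _ ⟩
    parity (cost (δ c x)) ∎
    where
    open ≡-Reasoning
    u = end e false
    w = end e true
    ε = opposite (cur x e false)
    η = opposite (cur x e true)
    z = bump (δ c x) u ε

  δ-cong : ∀ c y x → dist y x ≡ 0 → ∀ v → δ c y v ≡ δ c x v
  δ-cong c y x p v = cong (ℤ._+_ (c v)) (Σℤ.sum-cong-≗ λ e → cong (λ b → κ b e v) (same e))
    where
    zero-sum : ∀ {m} (f : Fin m → ℕ) → sumℕ f ≡ 0 → ∀ i → f i ≡ 0
    zero-sum {suc m} f q zero = ℕ.m+n≡0⇒m≡0 (f zero) q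
    zero-sum {suc m} f q (suc i) = zero-sum (f ∘ suc) (ℕ.m+n≡0⇒n≡0 (f zero) q) i
    differ-zero : ∀ a b → differ a b ≡ 0 → a ≡ b
    differ-zero false false q = refl
    differ-zero true true q = refl
    same : ∀ e → lookup y e ≡ lookup x e
    same e = differ-zero (lookup y e) (lookup x e) (zero-sum (λ i → differ (lookup y i) (lookup x i)) p e)

  cost-parity : ∀ c d y x → dist y x ≡ d → parity (cost (δ c y)) ≡ parity (cost (δ c x))
  cost-parity c zero y x p = cong parity (cost-cong (δ-cong c y x p))
  cost-parity c (suc d) y x p with differing-edge y x (λ q → ℕ.0≢1+n (trans (sym q) p))
  ... | e , differs = trans (sym (flip-parity c y e))
    (cost-parity c d (flip y e) x (ℕ.suc-injective (trans (sym (dist-flip y x e differs)) p)))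

-- Optimal states and a Gallai-type lemma

abstract
  -- Descent along smaller values, with the initial value as fuel. `anySubset?` can search the
  -- states because subsets are vectors of booleans.
  argmin : ∀ {m} {P : Vec Bool m → Set} → (∀ x → Dec (P x)) → (f : Vec Bool m → ℕ) → ∃ P →
    ∃ λ x → P x × (∀ y → P y → f x ℕ.≤ f y)
  argmin {m} {P} P? f (x₀ , p₀) = search (f x₀) x₀ p₀ ℕ.≤-refl
    where
    search : ∀ d x → P x → f x ℕ.≤ d → ∃ λ x → P x × (∀ y → P y → f x ℕ.≤ f y)
    search d x p b with anySubset? (λ y → P? y ×-dec (f y ℕ.<? f x))
    ... | no ¬better = x , p , λ y q → ℕ.≮⇒≥ (λ lt → ¬better (y , q , lt))
    search zero x p b | yes (y , q , lt) = contradiction (ℕ.<-≤-trans lt b) λ ()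
    search (suc d) x p b | yes (y , q , lt) = search d y q (ℕ.≤-pred (ℕ.<-≤-trans lt b))

step-in-sign : ∀ ε z → HasSign (opposite ε) z → 2 ℕ.≤ ∣ z ∣ → HasSign (opposite ε) (z ℤ.+ signℤ ε)
step-in-sign Sign.+ -[1+ suc k ] p _ = -<+
step-in-sign Sign.+ -[1+ zero ] p (ℕ.s≤s ())
step-in-sign Sign.+ (+ k) (+<+ ()) _
step-in-sign Sign.- (+ suc (suc k)) p _ = +<+ (ℕ.s≤s ℕ.z≤n)
step-in-sign Sign.- (+ suc zero) p (ℕ.s≤s ())

sign-opposite : ∀ ε ζ → ε ≢ ζ → ε ≡ opposite ζ
sign-opposite Sign.+ Sign.+ p = contradiction refl p
sign-opposite Sign.+ Sign.- p = refl
sign-opposite Sign.- Sign.+ p = refl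
sign-opposite Sign.- Sign.- p = contradiction refl p

across-zero : ∀ ε {a b} → HasSign (opposite ε) a → HasSign ε b → a ⟶[ ε ] b
across-zero ε p q = ⟶-trans ε (⟶-flip ε p) q

unit : ∀ {n} → Fin n → Fin n → ℕ
unit t s = ∣ single t Sign.+ s ∣

unit-self : ∀ {n} (t : Fin n) → unit t t ≡ 1
unit-self t = cong ∣_∣ (single-self t Sign.+)

unit-other : ∀ {n} {t s : Fin n} → t ≢ s → unit t s ≡ 0
unit-other p = cong ∣_∣ (single-other Sign.+ p)

sum-unit : ∀ {n} (t : Fin n) → sumℕ (unit t) ≡ 1
sum-unit {n} t = begin
  sumℕ (unit t) ≡⟨ ℕ.+-identityʳ _ ⟨
  sumℕ (unit t) ℕ.+ 0 ≡⟨ sum-change ℕ.+-0-commutativeMonoid (unit t) (λ _ → 0) t (λ i p → unit-other p) ⟩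
  sumℕ {n} (λ _ → 0) ℕ.+ unit t t ≡⟨ cong₂ ℕ._+_ (Σℕ.sum-replicate-zero n) (unit-self t) ⟩
  1 ∎
  where open ≡-Reasoning

module Optimal {n m : ℕ} (end : Fin m → Bool → Fin n) (out : Fin m → Bool → Sign)
  (c : Fin n → ℤ) (opt : ℕ)
  (minimal : ∀ y → opt ℕ.≤ cost (Bidirected.δ end out c y)) where
  open Bidirected end out

  IsOptimal : State → Set
  IsOptimal x = cost (δ c x) ≡ opt

  isOptimal? : ∀ x → Dec (IsOptimal x)
  isOptimal? x = cost (δ c x) ℕ.≟ opt

  Ambivalent : Fin n → Set
  Ambivalent v = ∀ ζ → ∃ λ x → IsOptimal x × HasSign ζ (δ c x v)

  -- Concluding `u ≡ v` rather than a contradiction makes the relation reflexive, so that it can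
  -- have classes.
  Separated : Fin n → Fin n → Set
  Separated u v = ∀ x → IsOptimal x → ∣ δ c x u ∣ ≢ 0 → ∣ δ c x v ∣ ≢ 0 → u ≡ v

  -- A trail from an optimal y that starts by lowering a defect has to end by raising one.
  record Exchange (y x : State) (s : Fin n) (ε : Sign) : Set where
    field
      new       : State
      isOptimal : IsOptimal new
      stop      : Fin n
      dir       : Sign
      closer    : dist new x ℕ.< dist y x
      effect    : ∀ v → δ c new v ≡ bump (bump (δ c y) s ε) stop dir v
      towards   : bump (δ c y) s ε stop ⟶[ dir ] δ c x stop
      outwards  : ¬ HasSign (opposite dir) (bump (δ c y) s ε stop)

    private
      z : Fin n → ℤ
      z = bump (δ c y) s ε

    -- The last move goes outwards: it may create or strengthen a sign at `stop`, but cannot destroy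
    -- one.
    keeps-sign : ∀ ζ t → HasSign ζ (z t) → HasSign ζ (δ c new t)
    keeps-sign ζ t p with stop ≟ t
    ... | no stop≢t = subst (HasSign ζ) (sym (trans (effect t) (bump-other z stop dir stop≢t))) p
    ... | yes refl with sign-unique-opp dir ζ p outwards
    ...   | refl = subst (HasSign ζ) (sym (trans (effect t) (bump-self z stop dir)))
                     (step-out-sign dir (z stop) outwards)

  abstract
    exchange : ∀ y x s ε → IsOptimal y → HasSign (opposite ε) (δ c y s) → δ c y s ⟶[ ε ] δ c x s → Exchange y x s ε
    exchange y x s ε y-opt inward p = record
      { new = target ; isOptimal = target-opt ; stop = stop ; dir = dir
      ; closer = closer ; effect = effect ; towards = towards ; outwards = outwards }
      where
      found : Trail c y x s ε
      found = trail c (dist y x) y x s ε ℕ.≤-refl p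
      open Trail {c} {y} {x} {s} {ε} found
      z : Fin n → ℤ
      z = bump (δ c y) s ε
      z-cost : opt ≡ suc (cost z)
      z-cost = trans (sym y-opt) (cost-bump-in (δ c y) s ε inward)
      target-cost : cost (δ c target) ≡ cost (bump z stop dir)
      target-cost = cost-cong effect
      -- The first move leaves cost `opt` minus one; an inward last move would give a state of cost
      -- `opt` minus two.
      outwards : ¬ HasSign (opposite dir) (z stop)
      outwards q = ℕ.<⇒≱ (ℕ.<-≤-trans (ℕ.≤-reflexive (sym (cost-bump-in z stop dir q))) (ℕ.≤-trans (ℕ.n≤1+n _) (ℕ.≤-reflexive (sym z-cost))))
        (ℕ.≤-trans (minimal target) (ℕ.≤-reflexive target-cost))
      target-opt : IsOptimal target
      target-opt = trans target-cost (trans (cost-bump-out z stop dir outwards) (sym z-cost))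

  record Closest (x : State) (v : Fin n) (ζ : Sign) : Set where
    field
      near      : State
      isOptimal : IsOptimal near
      signed    : HasSign ζ (δ c near v)
      nearest   : ∀ y → IsOptimal y → HasSign ζ (δ c y v) → dist near x ℕ.≤ dist y x

    -- The exchange would yield an optimal state nearer to `x` which, by `keeps-sign`, still has
    -- sign `ζ` at `v`.
    no-exchange : ∀ s ε → HasSign (opposite ε) (δ c near s) → δ c near s ⟶[ ε ] δ c x s →
      ¬ HasSign ζ (bump (δ c near) s ε v)
    no-exchange s ε p q r = ℕ.<⇒≱ closer (nearest new new-optimal (keeps-sign ζ v r))
      where open Exchange (exchange near x s ε isOptimal p q) renaming (isOptimal to new-optimal)

    -- A larger defect at `s` would allow an exchange towards `x` whose first move leaves `v` alone.
    dominated : ∀ {s} → s ≢ v → ∣ δ c near s ∣ ℕ.≤ ∣ δ c x s ∣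
    dominated {s} s≢v = ℕ.≮⇒≥ λ lt →
      let (ε , p , q) = larger-abs (δ c near s) (δ c x s) lt in
      no-exchange s ε p q (subst (HasSign ζ) (sym (bump-other (δ c near) s ε s≢v)) signed)

  abstract
    closest : ∀ {v} → Ambivalent v → ∀ x ζ → Closest x v ζ
    closest {v} amb x ζ with argmin (λ y → isOptimal? y ×-dec hasSign? ζ (δ c y v)) (λ y → dist y x) (amb ζ)
    ... | y , (y-opt , y-sign) , least = record
      { near = y ; isOptimal = y-opt ; signed = y-sign ; nearest = λ y′ p q → least y′ (p , q) }

  all-dominated⇒equal : ∀ x y → IsOptimal x → IsOptimal y → (∀ s → ∣ δ c y s ∣ ℕ.≤ ∣ δ c x s ∣) →
    ∀ s → ∣ δ c x s ∣ ℕ.≤ ∣ δ c y s ∣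
  all-dominated⇒equal x y p q d = sumℕ-tight d (ℕ.≤-reflexive (trans p (sym q)))

  -- Given a defect of size at least 2, take the nearest optimal state of the other sign at `v`.
  -- Domination elsewhere and equal costs make its defect at `v` at least as large, so a step
  -- towards zero keeps the sign there, which `no-exchange` forbids.
  ambivalent-bound : ∀ {v} → Ambivalent v → ∀ x → IsOptimal x → ∣ δ c x v ∣ ℕ.≤ 1
  ambivalent-bound {v} amb x x-opt = ℕ.≮⇒≥ large
    where
    large : ¬ 1 ℕ.< ∣ δ c x v ∣
    large two with sign-of (δ c x v) (ℕ.>⇒≢ (ℕ.<-trans ℕ.z<s two))
    ... | η , x-sign = no-exchange v η signed (across-zero η signed x-sign)
        (subst (HasSign (opposite η)) (sym (bump-self (δ c near) v η)) (step-in-sign η (δ c near v) signed (ℕ.≤-trans two at-least)))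
      where
      open Closest (closest amb x (opposite η))
      at-least : ∣ δ c x v ∣ ℕ.≤ ∣ δ c near v ∣
      at-least = ℕ.≮⇒≥ λ lt → ℕ.<⇒≱ lt (all-dominated⇒equal x near x-opt isOptimal (all≤ lt) v)
        where
        all≤ : ∣ δ c near v ∣ ℕ.< ∣ δ c x v ∣ → ∀ s → ∣ δ c near s ∣ ℕ.≤ ∣ δ c x s ∣
        all≤ lt s with s ≟ v
        ... | yes refl = ℕ.<⇒≤ lt
        ... | no s≢v = dominated s≢v

  separated-sym : ∀ {u v} → Separated u v → Separated v u
  separated-sym sep x p q r = sym (sep x p r q)

  -- An optimal state near x with a defect at t has none at u and v, so it would be cheaper than x.
  separated-trans : ∀ {u t v} → Ambivalent t → Separated u t → Separated t v → Separated u v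
  separated-trans {u} {t} {v} amb ut tv x x-opt u≠0 v≠0 with u ≟ v | u ≟ t | t ≟ v
  ... | yes u≡v | _ | _ = u≡v
  ... | no _ | yes refl | _ = tv x x-opt u≠0 v≠0
  ... | no _ | no _ | yes refl = ut x x-opt u≠0 v≠0
  ... | no u≢v | no u≢t | no t≢v = contradiction near-v v-gain
    where
    open Closest (closest amb x Sign.+)
    near-u : ∣ δ c near u ∣ ≡ 0
    near-u with ∣ δ c near u ∣ ℕ.≟ 0
    ... | yes p = p
    ... | no p = contradiction (ut near isOptimal p (signed⇒≢0 Sign.+ signed)) u≢t
    near-v : ∣ δ c near v ∣ ≡ 0
    near-v with ∣ δ c near v ∣ ℕ.≟ 0
    ... | yes p = p
    ... | no p = contradiction (tv near isOptimal (signed⇒≢0 Sign.+ signed) p) t≢v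
    -- Passing from `x` to `near` adds at most one unit at `t` and removes at least one at `u`. With
    -- these compensated the totals agree, so every term is tight; at `v` this contradicts `near-v`.
    pointwise : ∀ s → ∣ δ c near s ∣ ℕ.+ unit u s ℕ.≤ ∣ δ c x s ∣ ℕ.+ unit t s
    pointwise s with s ≟ t | s ≟ u
    ... | yes refl | _ = begin
      ∣ δ c near t ∣ ℕ.+ unit u t ≡⟨ cong (∣ δ c near t ∣ ℕ.+_) (unit-other u≢t) ⟩
      ∣ δ c near t ∣ ℕ.+ 0 ≡⟨ ℕ.+-identityʳ _ ⟩
      ∣ δ c near t ∣ ≤⟨ ambivalent-bound amb near isOptimal ⟩
      1 ≡⟨ unit-self t ⟨
      unit t t ≤⟨ ℕ.m≤n+m _ _ ⟩
      ∣ δ c x t ∣ ℕ.+ unit t t ∎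
      where open ℕ.≤-Reasoning
    ... | no s≢t | yes refl = begin
      ∣ δ c near u ∣ ℕ.+ unit u u ≡⟨ cong₂ ℕ._+_ near-u (unit-self u) ⟩
      1 ≤⟨ ℕ.n≢0⇒n>0 u≠0 ⟩
      ∣ δ c x u ∣ ≤⟨ ℕ.m≤m+n _ _ ⟩
      ∣ δ c x u ∣ ℕ.+ unit t u ∎
      where open ℕ.≤-Reasoning
    ... | no s≢t | no s≢u = ℕ.+-mono-≤ (dominated s≢t) (ℕ.≤-trans (ℕ.≤-reflexive (unit-other (s≢u ∘ sym))) ℕ.z≤n)
    totals : sumℕ (λ s → ∣ δ c x s ∣ ℕ.+ unit t s) ≡ sumℕ (λ s → ∣ δ c near s ∣ ℕ.+ unit u s)
    totals = begin
      sumℕ (λ s → ∣ δ c x s ∣ ℕ.+ unit t s) ≡⟨ Σℕ.∑-distrib-+ (λ s → ∣ δ c x s ∣) (unit t) ⟩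
      cost (δ c x) ℕ.+ sumℕ (unit t) ≡⟨ cong₂ ℕ._+_ (trans x-opt (sym isOptimal)) (trans (sum-unit t) (sym (sum-unit u))) ⟩
      cost (δ c near) ℕ.+ sumℕ (unit u) ≡⟨ Σℕ.∑-distrib-+ (λ s → ∣ δ c near s ∣) (unit u) ⟨
      sumℕ (λ s → ∣ δ c near s ∣ ℕ.+ unit u s) ∎
      where open ≡-Reasoning
    v-gain : ∣ δ c near v ∣ ≢ 0
    v-gain = ℕ.>⇒≢ (begin
      1 ≤⟨ ℕ.n≢0⇒n>0 v≠0 ⟩
      ∣ δ c x v ∣ ≤⟨ ℕ.m≤m+n _ _ ⟩
      ∣ δ c x v ∣ ℕ.+ unit t v ≤⟨ sumℕ-tight pointwise (ℕ.≤-reflexive totals) v ⟩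
      ∣ δ c near v ∣ ℕ.+ unit u v ≡⟨ cong (∣ δ c near v ∣ ℕ.+_) (unit-other u≢v) ⟩
      ∣ δ c near v ∣ ℕ.+ 0 ≡⟨ ℕ.+-identityʳ _ ⟩
      ∣ δ c near v ∣ ∎)
      where open ℕ.≤-Reasoning

  -- Flipping an edge that is inward at u would either lower the cost or pile up a defect of size 2 at v.
  no-inward : ∀ {e h u v} x → Ambivalent v → IsOptimal x → end e h ≡ u → end e (not h) ≡ v → u ≢ v →
    HasSign (cur x e h) (δ c x u) → ∣ δ c x v ∣ ≢ 0 → ⊥
  no-inward {e} {h} {u} {v} x amb x-opt refl refl u≢v u-sign v≠0 = outcome (hasSign? (opposite η) (z v))
    where
    ε = opposite (cur x e h)
    η = opposite (cur x e (not h))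
    z = bump (δ c x) u ε
    x₁ = flip x e
    effect : ∀ t → δ c x₁ t ≡ bump z v η t
    effect t = trans (δ-flip c x e t) (trans (cong (ℤ._+_ (δ c x t)) (step-from x e h t)) (sym (ℤ.+-assoc (δ c x t) _ _)))
    z-cost : opt ≡ suc (cost z)
    z-cost = trans (sym x-opt) (cost-bump-in (δ c x) u ε (subst (λ ζ → HasSign ζ (δ c x u)) (sym (Sign.opposite-involutive (cur x e h))) u-sign))
    outcome : Dec (HasSign (opposite η) (z v)) → ⊥
    outcome (yes p) = ℕ.<⇒≱ (ℕ.<-≤-trans (ℕ.≤-reflexive (sym (cost-bump-in z v η p))) (ℕ.≤-trans (ℕ.n≤1+n _) (ℕ.≤-reflexive (sym z-cost))))
      (ℕ.≤-trans (minimal x₁) (ℕ.≤-reflexive (cost-cong effect)))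
    outcome (no p) = ℕ.<⇒≱ big (ambivalent-bound amb x₁ x₁-opt)
      where
      x₁-opt : IsOptimal x₁
      x₁-opt = trans (cost-cong effect) (trans (cost-bump-out z v η p) (sym z-cost))
      big : 1 ℕ.< ∣ δ c x₁ v ∣
      big = begin
        2 ≤⟨ ℕ.s≤s (ℕ.n≢0⇒n>0 v≠0) ⟩
        suc ∣ δ c x v ∣ ≡⟨ cong (suc ∘ ∣_∣) (bump-other (δ c x) u ε u≢v) ⟨
        suc ∣ z v ∣ ≡⟨ step-out η (z v) p ⟨
        ∣ z v ℤ.+ signℤ η ∣ ≡⟨ cong ∣_∣ (bump-self z v η) ⟨
        ∣ bump z v η v ∣ ≡⟨ cong ∣_∣ (effect v) ⟨
        ∣ δ c x₁ v ∣ ∎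
        where open ℕ.≤-Reasoning

  outward : ∀ {e h u v ζ} x → Ambivalent v → IsOptimal x → end e h ≡ u → end e (not h) ≡ v → u ≢ v →
    HasSign ζ (δ c x u) → ∣ δ c x v ∣ ≢ 0 → ζ ≡ opposite (cur x e h)
  outward {ζ = ζ} x amb x-opt p q u≢v u-sign v≠0 = sign-opposite ζ _ λ { refl → no-inward x amb x-opt p q u≢v u-sign v≠0 }

  -- A trail from u would negate the defect at u and keep the one at v, but e has to be outward at both ends before and after.
  adjacent-separated : ∀ {e h u v} → Ambivalent u → Ambivalent v → end e h ≡ u → end e (not h) ≡ v → Separated u v
  adjacent-separated {e} {h} {u} {v} amb-u amb-v end-u end-v x x-opt u≠0 v≠0 with u ≟ v
  ... | yes u≡v = u≡v
  ... | no u≢v with sign-of (δ c x u) u≠0 | sign-of (δ c x v) v≠0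
  ...   | a , u-sign | b , v-sign = contradiction same-u (Sign.s≢opposite[s] a)
    where
    open Closest (closest amb-u x (opposite a))
    dominated-everywhere : ∀ s → ∣ δ c near s ∣ ℕ.≤ ∣ δ c x s ∣
    dominated-everywhere s with s ≟ u
    ... | yes refl = ℕ.≤-trans (ambivalent-bound amb-u near isOptimal) (ℕ.n≢0⇒n>0 u≠0)
    ... | no s≢u = dominated s≢u
    ε = opposite a
    u-sign′ : HasSign (opposite ε) (δ c x u)
    u-sign′ = subst (λ ζ → HasSign ζ (δ c x u)) (sym (Sign.opposite-involutive a)) u-sign
    open Exchange (exchange x near u ε x-opt u-sign′ (across-zero ε u-sign′ signed)) renaming (isOptimal to new-optimal)
    z = bump (δ c x) u ε
    -- Elsewhere the last move would lead away from zero towards the value in `near`, making `near`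
    -- larger there than `x`, against domination.
    stops-at-u : stop ≡ u
    stops-at-u with stop ≟ u
    ... | yes p = p
    ... | no p = contradiction
        (ℕ.<-≤-trans (away-not-toward dir (z stop) (δ c near stop) outwards towards)
          (subst (λ t → ∣ δ c near stop ∣ ℕ.≤ ∣ t ∣) (sym (bump-other (δ c x) u ε (p ∘ sym))) (dominated-everywhere stop)))
        (ℕ.<-irrefl refl)
    -- The defect at `u` has size 1, so the first move empties it and the last move recreates it
    -- with the reverse sign.
    z-u : z u ≡ + 0
    z-u = ℤ.∣i∣≡0⇒i≡0 (ℕ.n≤0⇒n≡0 (ℕ.≤-pred (begin
      suc ∣ z u ∣ ≡⟨ cong (suc ∘ ∣_∣) (bump-self (δ c x) u ε) ⟩
      suc ∣ δ c x u ℤ.+ signℤ ε ∣ ≡⟨ step-in ε (δ c x u) u-sign′ ⟨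
      ∣ δ c x u ∣ ≤⟨ ambivalent-bound amb-u x x-opt ⟩
      1 ∎)))
      where open ℕ.≤-Reasoning
    dir≡ε : dir ≡ ε
    dir≡ε = sign-unique dir ε (subst₂ (λ s t → t ⟶[ dir ] δ c near s) stops-at-u (trans (cong z stops-at-u) z-u) towards) signed
    new-u : HasSign ε (δ c new u)
    new-u = subst (HasSign ε) (sym (trans (effect u) (trans (cong (λ s → bump z s dir u) stops-at-u) (bump-self z u dir))))
      (subst (λ d → HasSign ε (z u ℤ.+ signℤ d)) (sym dir≡ε)
        (step-out-sign ε (z u) λ q → signed⇒≢0 (opposite ε) q (cong ∣_∣ z-u)))
    new-v : δ c new v ≡ δ c x v
    new-v = trans (effect v) (trans (bump-other z stop dir (λ s≡v → u≢v (trans (sym stops-at-u) s≡v))) (bump-other (δ c x) u ε u≢v))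
    new-v-sign : HasSign b (δ c new v)
    new-v-sign = subst (HasSign b) (sym new-v) v-sign
    end-u′ : end e (not (not h)) ≡ u
    end-u′ = trans (cong (end e) (Bool.not-involutive h)) end-u
    same-lookup : ∀ s t (o : Sign) → (if s then opposite o else o) ≡ (if t then opposite o else o) → s ≡ t
    same-lookup false false o p = refl
    same-lookup false true o p = contradiction p (Sign.s≢opposite[s] o)
    same-lookup true false o p = contradiction (sym p) (Sign.s≢opposite[s] o)
    same-lookup true true o p = refl
    -- The sign at `v` is the same in `x` and `new`, and `e` is outward there in both, so `e` has
    -- the same status in both. Being outward at `u` as well, it forces equal signs at `u`.
    lookups : lookup x e ≡ lookup new e
    lookups = same-lookup _ _ (out e (not h)) (Sign.opposite-injective (trans
      (sym (outward x amb-u x-opt end-v end-u′ (u≢v ∘ sym) v-sign u≠0))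
      (outward new amb-u new-optimal end-v end-u′ (u≢v ∘ sym) new-v-sign (signed⇒≢0 ε new-u))))
    same-u : a ≡ opposite a
    same-u = trans (outward x amb-v x-opt end-u end-v u≢v u-sign v≠0)
      (trans (cong (λ s → opposite (if s then opposite (out e h) else out e h)) lookups)
        (sym (outward new amb-v new-optimal end-u end-v u≢v new-u (signed⇒≢0 b new-v-sign))))

-- Shifting the target imbalances

term≤sum : ∀ {n} (f : Fin n → ℕ) i → f i ℕ.≤ sumℕ f
term≤sum f zero = ℕ.m≤m+n _ _
term≤sum f (suc i) = ℕ.≤-trans (term≤sum (f ∘ suc) i) (ℕ.m≤n+m _ (f zero))

module Shifting {n m : ℕ} (end : Fin m → Bool → Fin n) (out : Fin m → Bool → Sign) where
  open Bidirected end out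

  -- Adding `ζ` to `c v` encodes moving the target of `v` by one against `ζ`, so `δ c` measures
  -- deviations from the current targets. By `gain`, the minimum has grown by at least the total
  -- shift.
  record Target (c₀ : Fin n → ℤ) (opt₀ : ℕ) : Set where
    field
      c        : Fin n → ℤ
      opt      : ℕ
      minimal  : ∀ y → opt ℕ.≤ cost (δ c y)
      best     : State
      attained : cost (δ c best) ≡ opt
      gain     : opt₀ ℕ.+ cost (λ v → c v ℤ.- c₀ v) ℕ.≤ opt
    open Optimal end out c opt minimal public

  δ-bump : ∀ c v ζ x u → δ (bump c v ζ) x u ≡ bump (δ c x) v ζ u
  δ-bump c v ζ x u = ring-lemma (c u) _ _
    where ring-lemma : ∀ a b d → a ℤ.+ b ℤ.+ d ≡ a ℤ.+ d ℤ.+ b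
          ring-lemma = solve-∀

  module _ {c₀ : Fin n → ℤ} {opt₀ : ℕ} (T : Target c₀ opt₀) where
    open Target T

    -- A shift of `c v` in direction `ζ` then leads away from zero in every optimal state.
    Flaw : Fin n → Sign → Set
    Flaw v ζ = ¬ (∃ λ x → IsOptimal x × HasSign (opposite ζ) (δ c x v))

    -- Since all costs have the same parity, losing every optimal state raises the minimum by 2 before the shift.
    shift : ∀ v ζ → Flaw v ζ → Target c₀ opt₀
    shift v ζ none = record
      { c = bump c v ζ ; opt = suc opt ; minimal = minimal′ ; best = best
      ; attained = trans (cost′ best) (trans (cost-bump-out (δ c best) v ζ (λ p → none (best , attained , p))) (cong suc attained))
      ; gain = begin
          opt₀ ℕ.+ cost (λ u → bump c v ζ u ℤ.- c₀ u) ≡⟨ cong (opt₀ ℕ.+_) (cost-cong (λ u → ring-lemma (c u) _ (c₀ u))) ⟩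
          opt₀ ℕ.+ cost (bump (λ u → c u ℤ.- c₀ u) v ζ) ≤⟨ ℕ.+-monoʳ-≤ opt₀ (cost-bump-≤ (λ u → c u ℤ.- c₀ u) v ζ) ⟩
          opt₀ ℕ.+ suc (cost (λ u → c u ℤ.- c₀ u)) ≡⟨ ℕ.+-suc opt₀ _ ⟩
          suc (opt₀ ℕ.+ cost (λ u → c u ℤ.- c₀ u)) ≤⟨ ℕ.s≤s gain ⟩
          suc opt ∎
      }
      where
      open ℕ.≤-Reasoning
      ring-lemma : ∀ a b d → a ℤ.+ b ℤ.- d ≡ a ℤ.- d ℤ.+ b
      ring-lemma = solve-∀
      cost′ : ∀ y → cost (δ (bump c v ζ) y) ≡ cost (bump (δ c y) v ζ)
      cost′ y = cost-cong (δ-bump c v ζ y)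
      minimal′ : ∀ y → suc opt ℕ.≤ cost (δ (bump c v ζ) y)
      minimal′ y with hasSign? (opposite ζ) (δ c y v)
      ... | no p = ℕ.≤-trans (ℕ.s≤s (minimal y)) (ℕ.≤-reflexive (sym (trans (cost′ y) (cost-bump-out (δ c y) v ζ p))))
      ... | yes p = ℕ.≤-trans (ℕ.≤-pred (ℕ.≤-trans two-more (ℕ.≤-reflexive (cost-bump-in (δ c y) v ζ p)))) (ℕ.≤-reflexive (sym (cost′ y)))
        where
        one-more : opt ℕ.< cost (δ c y)
        one-more = ℕ.≤∧≢⇒< (minimal y) (λ q → none (y , sym q , p))
        two-more : suc opt ℕ.< cost (δ c y)
        two-more = ℕ.≤∧≢⇒< one-more λ q → Bool.not-¬ refl
          (sym (trans (cong parity q) (trans (cost-parity c (dist y best) y best refl) (cong parity attained))))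

    ambivalent-or-flawed : ∀ v → Ambivalent v ⊎ ∃ (Flaw v)
    ambivalent-or-flawed v with attains? Sign.+ | attains? Sign.-
      where attains? : ∀ ζ → Dec (∃ λ x → IsOptimal x × HasSign ζ (δ c x v))
            attains? ζ = anySubset? (λ x → isOptimal? x ×-dec hasSign? ζ (δ c x v))
    ... | no p | _ = inj₂ (Sign.- , p)
    ... | yes _ | no q = inj₂ (Sign.+ , q)
    ... | yes p | yes q = inj₁ λ { Sign.+ → p ; Sign.- → q }

    flawed? : ∀ v → Dec (∃ (Flaw v))
    flawed? v with ambivalent-or-flawed v
    ... | inj₁ amb = no λ { (ζ , none) → none (amb (opposite ζ)) }
    ... | inj₂ flaw = yes flaw

  Settled : ∀ {c₀ opt₀} → ℕ → Target c₀ opt₀ → Set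
  Settled M T = ∀ v → ¬ (M ℕ.≤ ∣ Target.c T v ∣) → Target.Ambivalent T v

  cost-bounded : ∀ c B → (∀ v → ∣ c v ∣ ℕ.≤ B) → cost (δ c (replicate m false)) ℕ.≤ sumℕ {n} (λ _ → B)
  cost-bounded c B bound = sumℕ-mono λ v → ℕ.≤-trans (ℕ.≤-reflexive (cong ∣_∣ (at-zero v))) (bound v)
    where
    at-zero : ∀ v → δ c (replicate m false) v ≡ c v
    at-zero v = trans (cong (ℤ._+_ (c v)) (trans (Σℤ.sum-cong-≗ {m} (λ e → cong (λ b → κ b e v) (lookup-replicate e false))) (Σℤ.sum-replicate-zero m)))
      (ℤ.+-identityʳ (c v))

  -- Only vertices with `∣ c v ∣` below `M` are shifted, so all values stay within `B`, and the
  -- unflipped state bounds the minimum by `n` times `B`. Each shift raises the minimum by one, so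
  -- the remaining gap serves as fuel.
  settle : ∀ {c₀ opt₀} M B → M ℕ.≤ B → ∀ fuel (T : Target c₀ opt₀) → (∀ v → ∣ Target.c T v ∣ ℕ.≤ B) →
    sumℕ {n} (λ _ → B) ℕ.≤ Target.opt T ℕ.+ fuel → ∃ (Settled {c₀} {opt₀} M)
  settle M B M≤B fuel T bound enough with any? (λ v → ¬? (M ℕ.≤? ∣ Target.c T v ∣) ×-dec flawed? T v)
  ... | no unflawed = T , λ v near → [ (λ amb → amb) , (λ flaw → contradiction (v , near , flaw) unflawed) ]′ (ambivalent-or-flawed T v)
  ... | yes (v , near , ζ , none) = continue fuel enough
    where
    open Target T
    T′ = shift T v ζ none
    bound′ : ∀ u → ∣ bump c v ζ u ∣ ℕ.≤ B
    bound′ u with v ≟ u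
    ... | no v≢u = ℕ.≤-trans (ℕ.≤-reflexive (cong ∣_∣ (ℤ.+-identityʳ (c u)))) (bound u)
    ... | yes refl = begin
      ∣ c v ℤ.+ signℤ ζ ∣ ≤⟨ ℤ.∣i+j∣≤∣i∣+∣j∣ (c v) (signℤ ζ) ⟩
      ∣ c v ∣ ℕ.+ ∣ signℤ ζ ∣ ≡⟨ cong (∣ c v ∣ ℕ.+_) (∣sign∣ ζ) ⟩
      ∣ c v ∣ ℕ.+ 1 ≡⟨ ℕ.+-comm _ 1 ⟩
      suc ∣ c v ∣ ≤⟨ ℕ.≰⇒> near ⟩
      M ≤⟨ M≤B ⟩
      B ∎
      where
      open ℕ.≤-Reasoning
      ∣sign∣ : ∀ ζ → ∣ signℤ ζ ∣ ≡ 1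
      ∣sign∣ Sign.+ = refl
      ∣sign∣ Sign.- = refl
    continue : ∀ fuel → sumℕ {n} (λ _ → B) ℕ.≤ opt ℕ.+ fuel → ∃ (Settled M)
    continue zero enough = contradiction
      (ℕ.≤-trans (Target.minimal T′ (replicate m false)) (ℕ.≤-trans (cost-bounded (bump c v ζ) B bound′)
        (ℕ.≤-trans enough (ℕ.≤-reflexive (ℕ.+-identityʳ opt)))))
      (ℕ.<-irrefl refl)
    continue (suc fuel) enough = settle M B M≤B fuel T′ bound′ (ℕ.≤-trans enough (ℕ.≤-reflexive (ℕ.+-suc opt fuel)))

  abstract
    settled-target : ∀ c₀ M → ∃₂ λ opt₀ (T : Target c₀ opt₀) →
      Settled M T × (∃ λ x → cost (δ c₀ x) ≡ opt₀)
    -- The condition is trivial, so `x` minimises over all states.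
    settled-target c₀ M with argmin {P = λ _ → ℕ.zero ≡ ℕ.zero} (λ _ → yes refl) (λ x → cost (δ c₀ x)) (replicate m false , refl)
    -- The bound `M ℕ.+ cost c₀` covers the threshold and all initial values.
    ... | x , _ , least with settle M (M ℕ.+ cost c₀) (ℕ.m≤m+n _ _) _ start
                              (λ v → ℕ.≤-trans (term≤sum (λ v → ∣ c₀ v ∣) v) (ℕ.m≤n+m _ M)) (ℕ.m≤n+m _ _)
      where
      start : Target c₀ (cost (δ c₀ x))
      start = record
        { c = c₀ ; opt = cost (δ c₀ x) ; minimal = λ y → least y refl ; best = x ; attained = refl
        ; gain = ℕ.≤-reflexive (trans (cong (cost (δ c₀ x) ℕ.+_)
            (trans (cost-cong (λ v → ℤ.+-inverseʳ (c₀ v))) (Σℕ.sum-replicate-zero n))) (ℕ.+-identityʳ _)) }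
    ...   | T , settled = cost (δ c₀ x) , T , settled , x , refl

-- Counting at the barrier

∣sum∣≤sum∣∣ : ∀ {n} (f : Fin n → ℤ) → ∣ sumℤ f ∣ ℕ.≤ sumℕ (λ i → ∣ f i ∣)
∣sum∣≤sum∣∣ {zero} f = ℕ.z≤n
∣sum∣≤sum∣∣ {suc n} f = ℕ.≤-trans (ℤ.∣i+j∣≤∣i∣+∣j∣ (f zero) _) (ℕ.+-monoʳ-≤ ∣ f zero ∣ (∣sum∣≤sum∣∣ (f ∘ suc)))

sum-unique-≤ : ∀ {n} (g : Fin n → ℕ) {s} → (∀ v → g v ℕ.≤ s) → (∀ u v → g u ≢ 0 → g v ≢ 0 → u ≡ v) → sumℕ g ℕ.≤ s
sum-unique-≤ {zero} g bound unique = ℕ.z≤n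
sum-unique-≤ {suc n} g {s} bound unique with g zero ℕ.≟ 0
... | yes p = ℕ.≤-trans (ℕ.≤-reflexive (cong (ℕ._+ sumℕ (g ∘ suc)) p))
    (sum-unique-≤ (g ∘ suc) (bound ∘ suc) (λ u v q r → suc-injective (unique (suc u) (suc v) q r)))
  where open import Data.Fin.Properties using (suc-injective)
... | no p = begin
    g zero ℕ.+ sumℕ (g ∘ suc) ≡⟨ cong (g zero ℕ.+_) (trans (Σℕ.sum-cong-≗ rest) (Σℕ.sum-replicate-zero n)) ⟩
    g zero ℕ.+ 0 ≡⟨ ℕ.+-identityʳ _ ⟩
    g zero ≤⟨ bound zero ⟩
    s ∎
  where
  open ℕ.≤-Reasoning
  rest : ∀ i → g (suc i) ≡ 0
  rest i with g (suc i) ℕ.≟ 0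
  ... | yes q = q
  ... | no q = contradiction (unique zero (suc i) p q) λ ()

abs-dominant : ∀ a s → ∣ s ∣ ℕ.≤ ∣ a ∣ → + ∣ a ℤ.+ s ∣ ≡ signℤ (ℤ.sign a) ℤ.* (a ℤ.+ s)
abs-dominant (+ k) (+ j) p = sym (ℤ.*-identityˡ (+ (k ℕ.+ j)))
abs-dominant (+ k) -[1+ j ] p = trans (cong (λ z → + ∣ z ∣) (ℤ.⊖-≥ p)) (sym (trans (ℤ.*-identityˡ _) (ℤ.⊖-≥ p)))
abs-dominant -[1+ k ] -[1+ j ] p = cong +_ (cong (ℕ.suc) (cong (ℕ.suc) (sym (ℕ.+-identityʳ _))))
abs-dominant -[1+ k ] (+ j) p = begin
  + ∣ j ℤ.⊖ suc k ∣ ≡⟨ cong +_ (ℤ.∣⊖∣-≤ p) ⟩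
  + (suc k ℕ.∸ j) ≡⟨ ℤ.neg-involutive _ ⟨
  ℤ.- (ℤ.- + (suc k ℕ.∸ j)) ≡⟨ cong ℤ.-_ (ℤ.⊖-≤ p) ⟨
  ℤ.- (j ℤ.⊖ suc k) ≡⟨ ℤ.-1*i≡-i _ ⟨
  ℤ.-1ℤ ℤ.* (j ℤ.⊖ suc k) ∎
  where open ≡-Reasoning

bit : Bool → ℕ
bit b = if b then 1 else 0

signedBit : Bool → Sign → ℤ
signedBit true  s = signℤ s
signedBit false s = + 0

signedBit-* : ∀ b s t → signedBit b s ℤ.* signℤ t ≡ signedBit b (s Sign.* t)
signedBit-* false s t = refl
signedBit-* true Sign.+ Sign.+ = refl
signedBit-* true Sign.+ Sign.- = refl
signedBit-* true Sign.- Sign.+ = refl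
signedBit-* true Sign.- Sign.- = refl

-- Here `a` and `b` tell which ends are far. Two far ends leave nothing to cover, one far end gains
-- 1 for one near end, and without far ends nothing is gained.
positive-covers : ∀ a b s t → + 0 ℤ.< signedBit a s ℤ.+ signedBit b t →
  + (bit (not a) ℕ.+ bit (not b)) ℤ.≤ signedBit a s ℤ.+ signedBit b t
positive-covers false false s t (+<+ ())
positive-covers false true s Sign.+ p = ℤ.≤-refl
positive-covers true false Sign.+ t p = ℤ.≤-refl
positive-covers true true Sign.+ Sign.+ p = +≤+ ℕ.z≤n
positive-covers true true Sign.+ Sign.- (+<+ ())
positive-covers true true Sign.- Sign.+ (+<+ ())

exactly-one-odd : ∀ a b s t → a ≡ not b → ∣ signedBit a s ℤ.+ signedBit b t ∣ ≡ 1
exactly-one-odd true false Sign.+ t p = refl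
exactly-one-odd true false Sign.- t p = refl
exactly-one-odd false true s Sign.+ p = refl
exactly-one-odd false true s Sign.- p = refl

-- Signs are invisible modulo 2. The explicit half `r` can be summed over the edges.
half-difference : ∀ a b s t → ∃ λ r → signedBit a s ℤ.+ signedBit b t ≡ + bit (a xor b) ℤ.+ + 2 ℤ.* r
half-difference false false s t = + 0 , refl
half-difference false true s Sign.+ = + 0 , refl
half-difference false true s Sign.- = -[1+ 0 ] , refl
half-difference true false Sign.+ t = + 0 , refl
half-difference true false Sign.- t = -[1+ 0 ] , refl
half-difference true true Sign.+ Sign.+ = + 1 , refl
half-difference true true Sign.+ Sign.- = + 0 , refl
half-difference true true Sign.- Sign.+ = + 0 , refl
half-difference true true Sign.- Sign.- = -[1+ 0 ] , refl

odd≢even : ∀ p ζ z → + (2 ℕ.* p ℕ.+ 1) ℤ.* signℤ ζ ≢ + 2 ℤ.* z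
odd≢even p ζ z eq = 2a+1≢2b p ∣ z ∣ (begin
    2 ℕ.* p ℕ.+ 1 ≡⟨ ℕ.*-identityʳ _ ⟨
    (2 ℕ.* p ℕ.+ 1) ℕ.* 1 ≡⟨ cong ((2 ℕ.* p ℕ.+ 1) ℕ.*_) (∣sign∣ ζ) ⟨
    (2 ℕ.* p ℕ.+ 1) ℕ.* ∣ signℤ ζ ∣ ≡⟨ ℤ.abs-* (+ (2 ℕ.* p ℕ.+ 1)) (signℤ ζ) ⟨
    ∣ + (2 ℕ.* p ℕ.+ 1) ℤ.* signℤ ζ ∣ ≡⟨ cong ∣_∣ eq ⟩
    ∣ + 2 ℤ.* z ∣ ≡⟨ ℤ.abs-* (+ 2) z ⟩
    2 ℕ.* ∣ z ∣ ∎)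
  where
  open ≡-Reasoning
  ∣sign∣ : ∀ ζ → ∣ signℤ ζ ∣ ≡ 1
  ∣sign∣ Sign.+ = refl
  ∣sign∣ Sign.- = refl
  2a+1≢2b : ∀ a b → 2 ℕ.* a ℕ.+ 1 ≢ 2 ℕ.* b
  2a+1≢2b a b q = ℕ.even≢odd b a (trans (sym q) (ℕ.+-comm _ 1))

count≡sum : ∀ {k} (P : Fin k → Bool) → count P ≡ sumℕ (λ i → bit (P i))
count≡sum {zero} P = refl
count≡sum {suc k} P = cong (bit (P zero) ℕ.+_) (count≡sum (P ∘ suc))

∣single∣ : ∀ {n} (s : Fin n) ε v → ∣ single s ε v ∣ ≡ unit s v
∣single∣ s ε v with s ≟ v | ε
... | yes _ | Sign.+ = refl
... | yes _ | Sign.- = refl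
... | no _ | _ = refl

sum-*-unit : ∀ {n} (g : Fin n → ℕ) s → sumℕ (λ v → g v ℕ.* unit s v) ≡ g s
sum-*-unit {n} g s = begin
  sumℕ f ≡⟨ ℕ.+-identityʳ _ ⟨
  sumℕ f ℕ.+ 0 ≡⟨ sum-change ℕ.+-0-commutativeMonoid f (λ _ → 0) s (λ i p → trans (cong (g i ℕ.*_) (unit-other p)) (ℕ.*-zeroʳ (g i))) ⟩
  sumℕ {n} (λ _ → 0) ℕ.+ f s ≡⟨ cong₂ ℕ._+_ (Σℕ.sum-replicate-zero n) (cong (g s ℕ.*_) (unit-self s)) ⟩
  g s ℕ.* 1 ≡⟨ ℕ.*-identityʳ _ ⟩
  g s ∎
  where
  open ≡-Reasoning
  f = λ v → g v ℕ.* unit s v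

bit-split : ∀ b k → k ≡ bit b ℕ.* k ℕ.+ bit (not b) ℕ.* k
bit-split false k = sym (ℕ.+-identityʳ k)
bit-split true k = sym (trans (ℕ.+-identityʳ _) (ℕ.+-identityʳ k))

signedBit-≤ : ∀ b s z → signedBit b s ℤ.* z ℤ.≤ + (bit b ℕ.* ∣ z ∣)
signedBit-≤ false s z = ℤ.≤-refl
signedBit-≤ true Sign.+ (+ k) = ℤ.≤-reflexive (trans (ℤ.*-identityˡ (+ k)) (cong +_ (sym (ℕ.+-identityʳ k))))
signedBit-≤ true Sign.+ -[1+ k ] = -≤+
signedBit-≤ true Sign.- (+ zero) = ℤ.≤-refl
signedBit-≤ true Sign.- (+ suc k) = -≤+
signedBit-≤ true Sign.- -[1+ k ] = ℤ.≤-refl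

-- `F x e` stands for the absolute flow value of `e` in state `x`; `balance` says that the boundary
-- is 2p+1 times the imbalance.
module Counting {n m : ℕ} (end : Fin m → Bool → Fin n) (out : Fin m → Bool → Sign)
  (c₀ : Fin n → ℤ) (p : ℕ) (F : Vec Bool m → Fin m → ℕ)
  (F-lower : ∀ x e → p ℕ.≤ F x e)
  (balance : ∀ x v → + (2 ℕ.* p ℕ.+ 1) ℤ.* Bidirected.δ end out c₀ x v ≡
     sumℤ (λ e → + F x e ℤ.* (single (end e false) (Bidirected.cur end out x e false) v ℤ.+
                              single (end e true) (Bidirected.cur end out x e true) v)))
  (bridgeless : ∀ (K : Fin n → Bool) → count (λ e → K (end e false) xor K (end e true)) ≢ 1) where
  open Bidirected end out
  open Shifting end out

  k : ℕ
  k = 2 ℕ.* p ℕ.+ 1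

  -- Summation by parts, applied below to a signed indicator of the far vertices and to the
  -- indicator of a class.
  weighted-balance : ∀ (g : Fin n → ℤ) x → + k ℤ.* sumℤ (λ v → g v ℤ.* δ c₀ x v) ≡
    sumℤ (λ e → + F x e ℤ.* (g (end e false) ℤ.* signℤ (cur x e false) ℤ.+ g (end e true) ℤ.* signℤ (cur x e true)))
  weighted-balance g x = begin
    + k ℤ.* sumℤ (λ v → g v ℤ.* δ c₀ x v) ≡⟨ Σℤ.*-distribˡ-sum (+ k) (λ v → g v ℤ.* δ c₀ x v) ⟩
    sumℤ (λ v → + k ℤ.* (g v ℤ.* δ c₀ x v)) ≡⟨ Σℤ.sum-cong-≗ (λ v → trans (swap (+ k) (g v) (δ c₀ x v)) (cong (ℤ._*_ (g v)) (balance x v))) ⟩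
    sumℤ (λ v → g v ℤ.* sumℤ (λ e → + F x e ℤ.* inc e v)) ≡⟨ Σℤ.sum-cong-≗ (λ v → Σℤ.*-distribˡ-sum (g v) (λ e → + F x e ℤ.* inc e v)) ⟩
    sumℤ (λ v → sumℤ (λ e → g v ℤ.* (+ F x e ℤ.* inc e v))) ≡⟨ Σℤ.∑-comm (λ v e → g v ℤ.* (+ F x e ℤ.* inc e v)) ⟩
    sumℤ (λ e → sumℤ (λ v → g v ℤ.* (+ F x e ℤ.* inc e v))) ≡⟨ Σℤ.sum-cong-≗ inner ⟩
    sumℤ (λ e → + F x e ℤ.* (g (end e false) ℤ.* signℤ (cur x e false) ℤ.+ g (end e true) ℤ.* signℤ (cur x e true))) ∎
    where
    open ≡-Reasoning
    inc : Fin m → Fin n → ℤ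
    inc e v = single (end e false) (cur x e false) v ℤ.+ single (end e true) (cur x e true) v
    swap : ∀ a b d → a ℤ.* (b ℤ.* d) ≡ b ℤ.* (a ℤ.* d)
    swap = solve-∀
    inner : ∀ e → sumℤ (λ v → g v ℤ.* (+ F x e ℤ.* inc e v)) ≡
      + F x e ℤ.* (g (end e false) ℤ.* signℤ (cur x e false) ℤ.+ g (end e true) ℤ.* signℤ (cur x e true))
    inner e = begin
      sumℤ (λ v → g v ℤ.* (+ F x e ℤ.* inc e v)) ≡⟨ Σℤ.sum-cong-≗ (λ v → swap (g v) (+ F x e) (inc e v)) ⟩
      sumℤ (λ v → + F x e ℤ.* (g v ℤ.* inc e v)) ≡⟨ Σℤ.*-distribˡ-sum (+ F x e) (λ v → g v ℤ.* inc e v) ⟨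
      + F x e ℤ.* sumℤ (λ v → g v ℤ.* inc e v)
        ≡⟨ cong (ℤ._*_ (+ F x e)) (trans (Σℤ.sum-cong-≗ (λ v → ℤ.*-distribˡ-+ (g v) _ _))
             (Σℤ.∑-distrib-+ (λ v → g v ℤ.* single (end e false) (cur x e false) v) (λ v → g v ℤ.* single (end e true) (cur x e true) v))) ⟩
      + F x e ℤ.* (sumℤ (λ v → g v ℤ.* single (end e false) (cur x e false) v) ℤ.+ sumℤ (λ v → g v ℤ.* single (end e true) (cur x e true) v))
        ≡⟨ cong (ℤ._*_ (+ F x e)) (cong₂ ℤ._+_ (sumℤ-single g (end e false) (cur x e false)) (sumℤ-single g (end e true) (cur x e true))) ⟩
      + F x e ℤ.* (g (end e false) ℤ.* signℤ (cur x e false) ℤ.+ g (end e true) ℤ.* signℤ (cur x e true)) ∎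

  -- Twice the number of edges: all flips together change an imbalance by at most 2 per edge, where
  -- 2 allows for loops.
  M : ℕ
  M = sumℕ {m} (λ _ → 2)

  ∣κ∣≤2 : ∀ b e v → ∣ κ b e v ∣ ℕ.≤ 2
  ∣κ∣≤2 false e v = ℕ.z≤n
  ∣κ∣≤2 true e v = ℕ.≤-trans (ℤ.∣i+j∣≤∣i∣+∣j∣ (single (end e false) _ v) _) (ℕ.+-mono-≤ (∣single∣≤1 (end e false) _) (∣single∣≤1 (end e true) _))
    where
    ∣single∣≤1 : ∀ s ε → ∣ single s ε v ∣ ℕ.≤ 1
    ∣single∣≤1 s ε = ℕ.≤-trans (ℕ.≤-reflexive (∣single∣ s ε v)) (ℕ.≤-trans (term≤sum (unit s) v) (ℕ.≤-reflexive (sum-unit s)))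

  -- Flips cannot push a value of size at least `M` across zero, so the absolute deviation is linear
  -- in `δ` here.
  far-abs : ∀ c x v → M ℕ.≤ ∣ c v ∣ → + ∣ δ c x v ∣ ≡ signℤ (ℤ.sign (c v)) ℤ.* δ c x v
  far-abs c x v q = abs-dominant (c v) _ (ℕ.≤-trans (∣sum∣≤sum∣∣ (λ e → κ (lookup x e) e v))
    (ℕ.≤-trans (sumℕ-mono (λ e → ∣κ∣≤2 (lookup x e) e v)) q))

  -- Far and near vertices

  module Barrier {opt₀ : ℕ} (T : Target c₀ opt₀) (settled : Settled M T) where
    open Target T

    far : Fin n → Bool
    far v = ⌊ M ℕ.≤? ∣ c v ∣ ⌋

    sgn : Fin n → Sign
    sgn v = ℤ.sign (c v)

    a : Fin n → ℤ
    a v = c v ℤ.- c₀ v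

    near-ambivalent : ∀ v → far v ≡ false → Ambivalent v
    near-ambivalent v p with M ℕ.≤? ∣ c v ∣
    ... | no q = settled v q

    weigh : (Fin n → Bool) → State → ℕ
    weigh P x = sumℕ (λ v → bit (P v) ℕ.* ∣ δ c x v ∣)

    cost-split : ∀ x → cost (δ c x) ≡ weigh far x ℕ.+ weigh (not ∘ far) x
    cost-split x = trans (Σℕ.sum-cong-≗ (λ v → bit-split (far v) ∣ δ c x v ∣)) (Σℕ.∑-distrib-+ (λ v → bit (far v) ℕ.* ∣ δ c x v ∣) _)

    far-term : ∀ x v → + (bit (far v) ℕ.* ∣ δ c x v ∣) ≡ signedBit (far v) (sgn v) ℤ.* δ c x v
    far-term x v with M ℕ.≤? ∣ c v ∣
    ... | yes q = trans (cong +_ (ℕ.+-identityʳ ∣ δ c x v ∣)) (far-abs c x v q)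
    ... | no _ = refl

    far-sum : ∀ x → + weigh far x ≡ sumℤ (λ v → signedBit (far v) (sgn v) ℤ.* δ c x v)
    far-sum x = trans (+-sum (λ v → bit (far v) ℕ.* ∣ δ c x v ∣)) (Σℤ.sum-cong-≗ (far-term x))

    -- Flipping e lowers the far cost by t x e (far-flip).
    t : State → Fin m → ℤ
    t x e = signedBit (far (end e false)) (sgn (end e false) Sign.* cur x e false) ℤ.+
            signedBit (far (end e true)) (sgn (end e true) Sign.* cur x e true)

    t-expand : ∀ x e → signedBit (far (end e false)) (sgn (end e false)) ℤ.* signℤ (cur x e false) ℤ.+
      signedBit (far (end e true)) (sgn (end e true)) ℤ.* signℤ (cur x e true) ≡ t x e
    t-expand x e = cong₂ ℤ._+_ (signedBit-* (far (end e false)) _ _) (signedBit-* (far (end e true)) _ _)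

    far-flip : ∀ x e → + weigh far (flip x e) ≡ + weigh far x ℤ.- t x e
    far-flip x e = begin
      + weigh far (flip x e) ≡⟨ far-sum (flip x e) ⟩
      sumℤ (λ v → g v ℤ.* δ c (flip x e) v) ≡⟨ Σℤ.sum-cong-≗ (λ v → trans (cong (ℤ._*_ (g v)) (δ-flip c x e v)) (expand (g v) (δ c x v) (s₀ v) (s₁ v))) ⟩
      sumℤ (λ v → g v ℤ.* δ c x v ℤ.+ (g v ℤ.* s₀ v ℤ.+ g v ℤ.* s₁ v))
        ≡⟨ trans (Σℤ.∑-distrib-+ (λ v → g v ℤ.* δ c x v) _) (cong (ℤ._+_ (sumℤ (λ v → g v ℤ.* δ c x v))) (Σℤ.∑-distrib-+ (λ v → g v ℤ.* s₀ v) _)) ⟩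
      sumℤ (λ v → g v ℤ.* δ c x v) ℤ.+ (sumℤ (λ v → g v ℤ.* s₀ v) ℤ.+ sumℤ (λ v → g v ℤ.* s₁ v))
        ≡⟨ cong₂ ℤ._+_ (sym (far-sum x)) (cong₂ ℤ._+_ (sumℤ-single g _ _) (sumℤ-single g _ _)) ⟩
      + weigh far x ℤ.+ (g (end e false) ℤ.* signℤ (opposite (cur x e false)) ℤ.+ g (end e true) ℤ.* signℤ (opposite (cur x e true)))
        ≡⟨ cong (ℤ._+_ (+ weigh far x)) (trans (cong₂ (λ i j → g (end e false) ℤ.* i ℤ.+ g (end e true) ℤ.* j)
               (opp-signℤ (cur x e false)) (opp-signℤ (cur x e true)))
             (collect (g (end e false)) (g (end e true)) _ _)) ⟩
      + weigh far x ℤ.- (g (end e false) ℤ.* signℤ (cur x e false) ℤ.+ g (end e true) ℤ.* signℤ (cur x e true))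
        ≡⟨ cong (λ i → + weigh far x ℤ.- i) (t-expand x e) ⟩
      + weigh far x ℤ.- t x e ∎
      where
      open ≡-Reasoning
      g = λ v → signedBit (far v) (sgn v)
      s₀ = single (end e false) (opposite (cur x e false))
      s₁ = single (end e true) (opposite (cur x e true))
      expand : ∀ g d a b → g ℤ.* (d ℤ.+ (a ℤ.+ b)) ≡ g ℤ.* d ℤ.+ (g ℤ.* a ℤ.+ g ℤ.* b)
      expand = solve-∀
      collect : ∀ g h a b → g ℤ.* (ℤ.- a) ℤ.+ h ℤ.* (ℤ.- b) ≡ ℤ.- (g ℤ.* a ℤ.+ h ℤ.* b)
      collect = solve-∀
      opp-signℤ : ∀ s → signℤ (opposite s) ≡ ℤ.- signℤ s
      opp-signℤ Sign.+ = refl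
      opp-signℤ Sign.- = refl

    near-flip : ∀ x e → weigh (not ∘ far) (flip x e) ℕ.≤ weigh (not ∘ far) x ℕ.+ (bit (not (far (end e false))) ℕ.+ bit (not (far (end e true))))
    near-flip x e = begin
      weigh (not ∘ far) (flip x e) ≤⟨ sumℕ-mono pointwise ⟩
      sumℕ (λ v → b v ℕ.* ∣ δ c x v ∣ ℕ.+ (b v ℕ.* unit (end e false) v ℕ.+ b v ℕ.* unit (end e true) v))
        ≡⟨ trans (Σℕ.∑-distrib-+ (λ v → b v ℕ.* ∣ δ c x v ∣) _) (cong (weigh (not ∘ far) x ℕ.+_)
             (trans (Σℕ.∑-distrib-+ (λ v → b v ℕ.* unit (end e false) v) _) (cong₂ ℕ._+_ (sum-*-unit b (end e false)) (sum-*-unit b (end e true))))) ⟩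
      weigh (not ∘ far) x ℕ.+ (b (end e false) ℕ.+ b (end e true)) ∎
      where
      open ℕ.≤-Reasoning
      b : Fin n → ℕ
      b v = bit (not (far v))
      pointwise : ∀ v → b v ℕ.* ∣ δ c (flip x e) v ∣ ℕ.≤ b v ℕ.* ∣ δ c x v ∣ ℕ.+ (b v ℕ.* unit (end e false) v ℕ.+ b v ℕ.* unit (end e true) v)
      pointwise v = begin
        b v ℕ.* ∣ δ c (flip x e) v ∣ ≡⟨ cong (λ i → b v ℕ.* ∣ i ∣) (δ-flip c x e v) ⟩
        b v ℕ.* ∣ δ c x v ℤ.+ step x e v ∣ ≤⟨ ℕ.*-monoʳ-≤ (b v) (ℕ.≤-trans (ℤ.∣i+j∣≤∣i∣+∣j∣ (δ c x v) _)
             (ℕ.+-monoʳ-≤ ∣ δ c x v ∣ (ℤ.∣i+j∣≤∣i∣+∣j∣ (single (end e false) (opposite (cur x e false)) v) _))) ⟩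
        b v ℕ.* (∣ δ c x v ∣ ℕ.+ (∣ single (end e false) (opposite (cur x e false)) v ∣ ℕ.+ ∣ single (end e true) (opposite (cur x e true)) v ∣))
          ≡⟨ cong₂ (λ i j → b v ℕ.* (∣ δ c x v ∣ ℕ.+ (i ℕ.+ j))) (∣single∣ (end e false) _ v) (∣single∣ (end e true) _ v) ⟩
        b v ℕ.* (∣ δ c x v ∣ ℕ.+ (unit (end e false) v ℕ.+ unit (end e true) v))
          ≡⟨ trans (ℕ.*-distribˡ-+ (b v) _ _) (cong (b v ℕ.* ∣ δ c x v ∣ ℕ.+_) (ℕ.*-distribˡ-+ (b v) _ _)) ⟩
        b v ℕ.* ∣ δ c x v ∣ ℕ.+ (b v ℕ.* unit (end e false) v ℕ.+ b v ℕ.* unit (end e true) v) ∎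

    least-far : ∃ λ x → IsOptimal x × (∀ y → IsOptimal y → weigh far x ℕ.≤ weigh far y)
    least-far = argmin isOptimal? (weigh far) (best , attained)

    module AtBarrier (x : State) (x-opt : IsOptimal x) (x-least : ∀ y → IsOptimal y → weigh far x ℕ.≤ weigh far y) where

      -- Otherwise flipping `e` lowers the far cost by `t x e` and raises the near cost by at most
      -- the number of near ends, which `positive-covers` bounds by `t x e`. The result would be
      -- optimal with smaller far cost.
      t≤0 : ∀ e → t x e ℤ.≤ + 0
      t≤0 e = ℤ.≮⇒≥ λ pos → ℕ.<⇒≱ (drop pos) (x-least (flip x e) (ℕ.≤-antisym (flip-cheap pos) (minimal (flip x e))))
        where
        sub-pos : ∀ a b → + 0 ℤ.< b → a ℤ.- b ℤ.< a
        sub-pos a b q = subst (a ℤ.- b ℤ.<_) (ℤ.+-identityʳ a) (ℤ.+-monoʳ-< a (ℤ.neg-mono-< q))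
        drop : + 0 ℤ.< t x e → weigh far (flip x e) ℕ.< weigh far x
        drop pos = ℤ.drop‿+<+ (subst (ℤ._< + weigh far x) (sym (far-flip x e)) (sub-pos _ (t x e) pos))
        flip-cheap : + 0 ℤ.< t x e → cost (δ c (flip x e)) ℕ.≤ opt
        flip-cheap pos = ℤ.drop‿+≤+ (begin
          + cost (δ c (flip x e)) ≡⟨ cong +_ (cost-split (flip x e)) ⟩
          + weigh far (flip x e) ℤ.+ + weigh (not ∘ far) (flip x e) ≡⟨ cong (ℤ._+ + weigh (not ∘ far) (flip x e)) (far-flip x e) ⟩
          + weigh far x ℤ.- t x e ℤ.+ + weigh (not ∘ far) (flip x e) ≤⟨ ℤ.+-monoʳ-≤ (+ weigh far x ℤ.- t x e)
               (ℤ.≤-trans (+≤+ (near-flip x e)) (ℤ.+-monoʳ-≤ (+ weigh (not ∘ far) x) (positive-covers (far (end e false)) (far (end e true)) _ _ pos))) ⟩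
          + weigh far x ℤ.- t x e ℤ.+ (+ weigh (not ∘ far) x ℤ.+ t x e) ≡⟨ cancel (+ weigh far x) (t x e) (+ weigh (not ∘ far) x) ⟩
          + weigh far x ℤ.+ + weigh (not ∘ far) x ≡⟨ cong +_ (cost-split x) ⟨
          + cost (δ c x) ≡⟨ cong +_ x-opt ⟩
          + opt ∎)
          where
          open ℤ.≤-Reasoning
          cancel : ∀ a b d → a ℤ.- b ℤ.+ (d ℤ.+ b) ≡ a ℤ.+ d
          cancel = solve-∀

      s : Fin m → ℕ
      s e = ∣ t x e ∣

      s-neg : ∀ e → t x e ≡ ℤ.- + s e
      s-neg e = nonpos (t x e) (t≤0 e)
        where
        nonpos : ∀ z → z ℤ.≤ + 0 → z ≡ ℤ.- + ∣ z ∣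
        nonpos (+ zero) q = refl
        nonpos (+ suc j) (+≤+ ())
        nonpos -[1+ j ] q = refl

      W A N : ℕ
      W = sumℕ (λ e → F x e ℕ.* s e)
      A = sumℕ (λ v → bit (not (far v)) ℕ.* ∣ a v ∣)
      N = weigh (not ∘ far) x

      shifted : ∀ v → δ c x v ≡ δ c₀ x v ℤ.+ a v
      shifted v = ring-lemma (c v) (c₀ v) _
        where ring-lemma : ∀ c c₀ d → c ℤ.+ d ≡ c₀ ℤ.+ d ℤ.+ (c ℤ.- c₀)
              ring-lemma = solve-∀

      -- The signed far indicator turns the balance into the sum of `F x e` times `t x e`, and no
      -- `t x e` is positive.
      far-total : + k ℤ.* sumℤ (λ v → signedBit (far v) (sgn v) ℤ.* δ c₀ x v) ≡ ℤ.- + W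
      far-total = begin
        + k ℤ.* sumℤ (λ v → signedBit (far v) (sgn v) ℤ.* δ c₀ x v) ≡⟨ weighted-balance (λ v → signedBit (far v) (sgn v)) x ⟩
        _ ≡⟨ Σℤ.sum-cong-≗ (λ e → trans (cong (ℤ._*_ (+ F x e)) (trans (t-expand x e) (s-neg e))) (move (F x e) (s e))) ⟩
        sumℤ (λ e → ℤ.-1ℤ ℤ.* + (F x e ℕ.* s e)) ≡⟨ Σℤ.*-distribˡ-sum ℤ.-1ℤ (λ e → + (F x e ℕ.* s e)) ⟨
        ℤ.-1ℤ ℤ.* sumℤ (λ e → + (F x e ℕ.* s e)) ≡⟨ cong (ℤ._*_ ℤ.-1ℤ) (+-sum (λ e → F x e ℕ.* s e)) ⟨
        ℤ.-1ℤ ℤ.* + W ≡⟨ ℤ.-1*i≡-i (+ W) ⟩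
        ℤ.- + W ∎
        where
        open ≡-Reasoning
        move : ∀ f s → + f ℤ.* (ℤ.- + s) ≡ ℤ.-1ℤ ℤ.* + (f ℕ.* s)
        move f s = trans (sym (ℤ.neg-distribʳ-* (+ f) (+ s))) (trans (cong ℤ.-_ (sym (ℤ.pos-* f s))) (sym (ℤ.-1*i≡-i _)))

      A-far : ℕ
      A-far = sumℕ (λ v → bit (far v) ℕ.* ∣ a v ∣)

      a-split : cost a ≡ A-far ℕ.+ A
      a-split = trans (Σℕ.sum-cong-≗ (λ v → bit-split (far v) ∣ a v ∣)) (Σℕ.∑-distrib-+ (λ v → bit (far v) ℕ.* ∣ a v ∣) _)

      far-bound : + weigh far x ℤ.≤ sumℤ (λ v → signedBit (far v) (sgn v) ℤ.* δ c₀ x v) ℤ.+ + A-far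
      far-bound = begin
        + weigh far x ≡⟨ far-sum x ⟩
        sumℤ (λ v → signedBit (far v) (sgn v) ℤ.* δ c x v)
          ≡⟨ Σℤ.sum-cong-≗ (λ v → trans (cong (ℤ._*_ (signedBit (far v) (sgn v))) (shifted v)) (ℤ.*-distribˡ-+ (signedBit (far v) (sgn v)) _ _)) ⟩
        sumℤ (λ v → signedBit (far v) (sgn v) ℤ.* δ c₀ x v ℤ.+ signedBit (far v) (sgn v) ℤ.* a v)
          ≡⟨ Σℤ.∑-distrib-+ (λ v → signedBit (far v) (sgn v) ℤ.* δ c₀ x v) _ ⟩
        Q ℤ.+ sumℤ (λ v → signedBit (far v) (sgn v) ℤ.* a v)
          ≤⟨ ℤ.+-monoʳ-≤ Q (sumℤ-mono (λ v → signedBit-≤ (far v) (sgn v) (a v))) ⟩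
        Q ℤ.+ sumℤ (λ v → + (bit (far v) ℕ.* ∣ a v ∣)) ≡⟨ cong (ℤ._+_ Q) (+-sum (λ v → bit (far v) ℕ.* ∣ a v ∣)) ⟨
        Q ℤ.+ + A-far ∎
        where
        open ℤ.≤-Reasoning
        Q = sumℤ (λ v → signedBit (far v) (sgn v) ℤ.* δ c₀ x v)

      -- By `gain`, the original minimum plus all shifts is at most the far cost plus `N`. The far
      -- shifts cancel through `far-bound`, and `k` times the remaining signed sum is minus `W`.
      barrier-bound : k ℕ.* (opt₀ ℕ.+ A) ℕ.+ W ℕ.≤ k ℕ.* N
      barrier-bound = ℤ.drop‿+≤+ (begin
        + (k ℕ.* (opt₀ ℕ.+ A) ℕ.+ W) ≡⟨ cong (ℤ._+ + W) (ℤ.pos-* k (opt₀ ℕ.+ A)) ⟩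
        + k ℤ.* + (opt₀ ℕ.+ A) ℤ.+ + W ≤⟨ ℤ.+-monoˡ-≤ (+ W) (ℤ.*-monoˡ-≤-nonNeg (+ k) reduced) ⟩
        + k ℤ.* (Q ℤ.+ + N) ℤ.+ + W ≡⟨ cong (ℤ._+ + W) (ℤ.*-distribˡ-+ (+ k) Q (+ N)) ⟩
        + k ℤ.* Q ℤ.+ + k ℤ.* + N ℤ.+ + W ≡⟨ cong (λ i → i ℤ.+ + k ℤ.* + N ℤ.+ + W) far-total ⟩
        ℤ.- + W ℤ.+ + k ℤ.* + N ℤ.+ + W ≡⟨ cancel (+ W) (+ k ℤ.* + N) ⟩
        + k ℤ.* + N ≡⟨ ℤ.pos-* k N ⟨
        + (k ℕ.* N) ∎)
        where
        open ℤ.≤-Reasoning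
        Q = sumℤ (λ v → signedBit (far v) (sgn v) ℤ.* δ c₀ x v)
        cancel : ∀ w n → ℤ.- w ℤ.+ n ℤ.+ w ≡ n
        cancel = solve-∀
        rearrange₁ : ∀ o f a → ℤ.- f ℤ.+ (o ℤ.+ (f ℤ.+ a)) ≡ o ℤ.+ a
        rearrange₁ = solve-∀
        rearrange₂ : ∀ q f n → ℤ.- f ℤ.+ (q ℤ.+ f ℤ.+ n) ≡ q ℤ.+ n
        rearrange₂ = solve-∀
        reduced : + (opt₀ ℕ.+ A) ℤ.≤ Q ℤ.+ + N
        reduced = subst₂ ℤ._≤_ (rearrange₁ (+ opt₀) (+ A-far) (+ A)) (rearrange₂ Q (+ A-far) (+ N)) (ℤ.+-monoʳ-≤ (ℤ.- + A-far) (begin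
          + (opt₀ ℕ.+ (A-far ℕ.+ A)) ≡⟨ cong (λ i → + (opt₀ ℕ.+ i)) a-split ⟨
          + (opt₀ ℕ.+ cost a) ≤⟨ +≤+ gain ⟩
          + opt ≡⟨ cong +_ (trans (sym x-opt) (cost-split x)) ⟩
          + weigh far x ℤ.+ + N ≤⟨ ℤ.+-monoˡ-≤ (+ N) far-bound ⟩
          Q ℤ.+ + A-far ℤ.+ + N ∎))

      -- Classes of near vertices

      separated? : ∀ u v → Dec (Separated u v)
      separated? u v with anySubset? (λ y → isOptimal? y ×-dec (¬? (∣ δ c y u ∣ ℕ.≟ 0) ×-dec (¬? (∣ δ c y v ∣ ℕ.≟ 0) ×-dec ¬? (u ≟ v))))
      ... | yes (y , y-opt , u≠0 , v≠0 , u≢v) = no λ sep → u≢v (sep y y-opt u≠0 v≠0)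
      ... | no none = yes λ y y-opt u≠0 v≠0 → decidable-stable (u ≟ v) λ u≢v → none (y , y-opt , u≠0 , v≠0 , u≢v)

      K : Fin n → Fin n → Bool
      K v u = not (far u) ∧ ⌊ separated? v u ⌋

      K-sound : ∀ v u → K v u ≡ true → far u ≡ false × Separated v u
      K-sound v u q with far u | separated? v u
      ... | false | yes sep = refl , sep

      K-complete : ∀ v u → far u ≡ false → Separated v u → K v u ≡ true
      K-complete v u near sep with far u | separated? v u
      ... | false | yes _ = refl
      ... | false | no ¬sep = contradiction sep ¬sep

      K-self : ∀ v → far v ≡ false → K v v ≡ true
      K-self v near = K-complete v v near λ _ _ _ _ → refl

      -- As a factor in sums over `v`, this selects the deviating near vertices as representatives
      -- of their classes, so no quotient is formed.
      d : Fin n → ℕ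
      d v = bit (not (far v)) ℕ.* ∣ δ c x v ∣

      d-support : ∀ v → d v ≢ 0 → far v ≡ false × ∣ δ c x v ∣ ≢ 0
      d-support v q with far v
      ... | true = contradiction refl q
      ... | false = refl , λ r → q (trans (ℕ.+-identityʳ _) r)

      d≤1 : ∀ v → d v ℕ.≤ 1
      d≤1 v with d v ℕ.≟ 0
      ... | yes q = ℕ.≤-trans (ℕ.≤-reflexive q) ℕ.z≤n
      ... | no q with d-support v q
      ...   | near , _ = ℕ.≤-trans (ℕ.≤-reflexive (trans (cong (λ b → bit (not b) ℕ.* ∣ δ c x v ∣) near) (ℕ.+-identityʳ _)))
                          (ambivalent-bound (near-ambivalent v near) x x-opt)

      cross : Fin n → Fin m → Bool
      cross v e = K v (end e false) xor K v (end e true)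

      -- Through the common member `u` the two vertices are separated; both deviate in `x`, so they
      -- coincide.
      K-disjoint : ∀ v v′ u → d v ≢ 0 → d v′ ≢ 0 → K v u ≡ true → K v′ u ≡ true → v ≡ v′
      K-disjoint v v′ u q q′ r r′ with K-sound v u r | K-sound v′ u r′
      ... | near , sep | _ , sep′ = separated-trans (near-ambivalent u near) sep (separated-sym sep′) x x-opt
                                      (proj₂ (d-support v q)) (proj₂ (d-support v′ q′))

      -- Adjacent near vertices are separated, so by transitivity a class contains all near
      -- neighbours of its members.
      outside-far : ∀ v e h → K v (end e h) ≡ true → K v (end e (not h)) ≡ false → far (end e (not h)) ≡ true
      outside-far v e h inside outside with far (end e (not h)) Bool.≟ false
      ... | no q = Bool.¬-not q
      ... | yes near with K-sound v (end e h) inside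
      ...   | z-near , sep = contradiction
                (trans (sym (K-complete v (end e (not h)) near (separated-trans z-amb sep
                  (adjacent-separated {e} {h} z-amb (near-ambivalent _ near) refl refl)))) outside)
                λ ()
        where z-amb = near-ambivalent (end e h) z-near

      crossing-half : ∀ v e → cross v e ≡ true → ∃ λ h → K v (end e h) ≡ true × far (end e (not h)) ≡ true
      crossing-half v e q with K v (end e false) in eq₀ | K v (end e true) in eq₁
      ... | true | false = false , eq₀ , outside-far v e false eq₀ eq₁
      ... | false | true = true , eq₁ , outside-far v e true eq₁ eq₀

      -- A crossing edge has exactly one near end, which lies in both classes.
      crossing-disjoint : ∀ v v′ e → d v ≢ 0 → d v′ ≢ 0 → cross v e ≡ true → cross v′ e ≡ true → v ≡ v′
      crossing-disjoint v v′ e q q′ r r′ with crossing-half v e r | crossing-half v′ e r′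
      ... | h , inside , outside | h′ , inside′ , outside′ with h Bool.≟ h′
      ...   | yes refl = K-disjoint v v′ (end e h) q q′ inside inside′
      ...   | no h≢h′ = contradiction
                (trans (sym outside) (trans (cong (far ∘ end e) (sym (Bool.¬-not (h≢h′ ∘ sym)))) (proj₁ (K-sound v′ (end e h′) inside′))))
                λ ()

      crossing-s : ∀ v e → cross v e ≡ true → s e ≡ 1
      crossing-s v e q with crossing-half v e q
      ... | false , inside , outside = exactly-one-odd (far (end e false)) (far (end e true)) _ _
              (trans (proj₁ (K-sound v _ inside)) (cong not (sym outside)))
      ... | true , inside , outside = exactly-one-odd (far (end e false)) (far (end e true)) _ _
              (trans outside (cong not (sym (proj₁ (K-sound v _ inside)))))

      class-shift class-cut : Fin n → ℕ
      class-shift v = sumℕ (λ u → bit (K v u) ℕ.* ∣ a u ∣)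
      class-cut v = sumℕ (λ e → bit (cross v e) ℕ.* F x e)

      -- The parity of ∂f on K v forces the cut to have weight at least k, or to be a bridge.
      class-bound : ∀ v → d v ≢ 0 → k ℕ.≤ k ℕ.* class-shift v ℕ.+ class-cut v
      class-bound v q with class-shift v ℕ.≟ 0
      -- A class containing a shifted vertex reaches the bound by its shift alone.
      ... | no r = ℕ.≤-trans (ℕ.≤-trans (ℕ.≤-reflexive (sym (ℕ.*-identityʳ k))) (ℕ.*-monoʳ-≤ k (ℕ.n≢0⇒n>0 r))) (ℕ.m≤m+n _ _)
      ... | yes r = ℕ.≤-trans (ℕ.≮⇒≥ light) (ℕ.m≤n+m _ _)
        where
        near = proj₁ (d-support v q)
        defect = proj₂ (d-support v q)
        ζ : Sign
        ζ = proj₁ (sign-of (δ c x v) defect)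
        ζ-sign : HasSign ζ (δ c x v)
        ζ-sign = proj₂ (sign-of (δ c x v) defect)

        δ-v : δ c x v ≡ signℤ ζ
        δ-v = trans (signed-abs ζ ζ-sign) (trans (cong (λ i → signℤ ζ ℤ.* + i)
                (ℕ.≤-antisym (ambivalent-bound (near-ambivalent v near) x x-opt) (ℕ.n≢0⇒n>0 defect))) (ℤ.*-identityʳ _))

        unshifted : ∀ u → K v u ≡ true → δ c₀ x u ≡ δ c x u
        unshifted u inside = trans (sym (ℤ.+-identityʳ _)) (trans (cong (ℤ._+_ (δ c₀ x u)) (sym a≡0)) (sym (shifted u)))
          where
          a≡0 : a u ≡ + 0
          a≡0 = ℤ.∣i∣≡0⇒i≡0 (ℕ.n≤0⇒n≡0 (ℕ.≤-trans
            (ℕ.≤-reflexive (sym (trans (cong (λ b → bit b ℕ.* ∣ a u ∣) inside) (ℕ.+-identityʳ _))))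
            (ℕ.≤-trans (term≤sum (λ u → bit (K v u) ℕ.* ∣ a u ∣) u) (ℕ.≤-reflexive r))))

        -- No vertex of the class other than `v` deviates in `x`. The factor `+ 1` fits the shape of
        -- `sumℤ-single`.
        class-term : ∀ u → signedBit (K v u) Sign.+ ℤ.* δ c₀ x u ≡ + 1 ℤ.* single v ζ u
        class-term u = trans (term (v ≟ u)) (sym (ℤ.*-identityˡ (single v ζ u)))
          where
          inner : ∀ u → K v u ≡ true → signedBit (K v u) Sign.+ ℤ.* δ c₀ x u ≡ δ c x u
          inner u inside = trans (cong (λ b → signedBit b Sign.+ ℤ.* δ c₀ x u) inside) (trans (ℤ.*-identityˡ _) (unshifted u inside))
          term : Dec (v ≡ u) → signedBit (K v u) Sign.+ ℤ.* δ c₀ x u ≡ single v ζ u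
          term (yes refl) = trans (inner v (K-self v near)) (trans δ-v (sym (single-self v ζ)))
          term (no v≢u) with K v u Bool.≟ true
          ... | no outside = trans (cong (λ b → signedBit b Sign.+ ℤ.* δ c₀ x u) (Bool.¬-not outside)) (sym (single-other ζ v≢u))
          ... | yes inside = trans (inner u inside) (trans (ℤ.∣i∣≡0⇒i≡0 (decidable-stable (_ ℕ.≟ 0)
                  (λ u≠0 → v≢u (proj₂ (K-sound v u inside) x x-opt defect u≠0)))) (sym (single-other ζ v≢u)))

        half : ∀ e → ∃ λ r → signedBit (K v (end e false)) (cur x e false) ℤ.+ signedBit (K v (end e true)) (cur x e true) ≡ + bit (cross v e) ℤ.+ + 2 ℤ.* r
        half e = half-difference (K v (end e false)) (K v (end e true)) _ _

        R : ℤ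
        R = sumℤ (λ e → + F x e ℤ.* proj₁ (half e))

        class-parity : + k ℤ.* signℤ ζ ≡ + class-cut v ℤ.+ + 2 ℤ.* R
        class-parity = begin
          + k ℤ.* signℤ ζ ≡⟨ cong (ℤ._*_ (+ k)) (trans (Σℤ.sum-cong-≗ class-term) (trans (sumℤ-single (λ _ → + 1) v ζ) (ℤ.*-identityˡ _))) ⟨
          + k ℤ.* sumℤ (λ u → signedBit (K v u) Sign.+ ℤ.* δ c₀ x u) ≡⟨ weighted-balance (λ u → signedBit (K v u) Sign.+) x ⟩
          _ ≡⟨ Σℤ.sum-cong-≗ (λ e → cong (ℤ._*_ (+ F x e)) (trans (cong₂ ℤ._+_
                 (signedBit-* (K v (end e false)) _ _) (signedBit-* (K v (end e true)) _ _)) (proj₂ (half e)))) ⟩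
          sumℤ (λ e → + F x e ℤ.* (+ bit (cross v e) ℤ.+ + 2 ℤ.* proj₁ (half e)))
            ≡⟨ Σℤ.sum-cong-≗ (λ e → trans (expand (+ F x e) (+ bit (cross v e)) (proj₁ (half e)))
                 (cong (ℤ._+ + 2 ℤ.* (+ F x e ℤ.* proj₁ (half e))) (sym (ℤ.pos-* (bit (cross v e)) (F x e))))) ⟩
          sumℤ (λ e → + (bit (cross v e) ℕ.* F x e) ℤ.+ + 2 ℤ.* (+ F x e ℤ.* proj₁ (half e))) ≡⟨ Σℤ.∑-distrib-+ (λ e → + (bit (cross v e) ℕ.* F x e)) _ ⟩
          sumℤ (λ e → + (bit (cross v e) ℕ.* F x e)) ℤ.+ sumℤ (λ e → + 2 ℤ.* (+ F x e ℤ.* proj₁ (half e)))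
            ≡⟨ cong₂ ℤ._+_ (sym (+-sum (λ e → bit (cross v e) ℕ.* F x e))) (sym (Σℤ.*-distribˡ-sum (+ 2) (λ e → + F x e ℤ.* proj₁ (half e)))) ⟩
          + class-cut v ℤ.+ + 2 ℤ.* R ∎
          where
          open ≡-Reasoning
          expand : ∀ f b r → f ℤ.* (b ℤ.+ + 2 ℤ.* r) ≡ b ℤ.* f ℤ.+ + 2 ℤ.* (f ℤ.* r)
          expand = solve-∀

        cut-not-even : ∀ j → class-cut v ≢ 2 ℕ.* j
        cut-not-even j eq = odd≢even p ζ (+ j ℤ.+ R) (trans class-parity
          (trans (cong (λ i → + i ℤ.+ + 2 ℤ.* R) eq) (trans (cong (ℤ._+ + 2 ℤ.* R) (ℤ.pos-* 2 j)) (sym (ℤ.*-distribˡ-+ (+ 2) (+ j) R)))))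

        cut-lower : count (cross v) ℕ.* p ℕ.≤ class-cut v
        cut-lower = begin
          count (cross v) ℕ.* p ≡⟨ cong (ℕ._* p) (count≡sum (cross v)) ⟩
          sumℕ (λ e → bit (cross v e)) ℕ.* p ≡⟨ Σℕ.*-distribʳ-sum p (λ e → bit (cross v e)) ⟩
          sumℕ (λ e → bit (cross v e) ℕ.* p) ≤⟨ sumℕ-mono (λ e → ℕ.*-monoʳ-≤ (bit (cross v e)) (F-lower x e)) ⟩
          class-cut v ∎
          where open ℕ.≤-Reasoning

        light : ¬ class-cut v ℕ.< k
        light lt with count (cross v) in eq
        ... | 1 = bridgeless (K v) eq
        ... | 0 = cut-not-even 0 (trans (Σℕ.sum-cong-≗ vanish) (Σℕ.sum-replicate-zero m))
          where
          vanish : ∀ e → bit (cross v e) ℕ.* F x e ≡ 0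
          vanish e = cong (ℕ._* F x e) (ℕ.n≤0⇒n≡0 (ℕ.≤-trans (term≤sum (λ e → bit (cross v e)) e)
            (ℕ.≤-reflexive (trans (sym (count≡sum (cross v))) eq))))
        -- Two crossing edges already weigh `2 ℕ.* p`, so a cut lighter than `k` weighs exactly
        -- this, an even number.
        ... | suc (suc j) = cut-not-even p (ℕ.≤-antisym
              (ℕ.≤-pred (ℕ.≤-trans lt (ℕ.≤-reflexive (ℕ.+-comm _ 1))))
              (ℕ.≤-trans (ℕ.*-monoˡ-≤ p (ℕ.s≤s (ℕ.s≤s (ℕ.z≤n {j})))) (subst (λ i → i ℕ.* p ℕ.≤ class-cut v) eq cut-lower)))

      class-bound-* : ∀ v → k ℕ.* d v ℕ.≤ d v ℕ.* (k ℕ.* class-shift v ℕ.+ class-cut v)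
      class-bound-* v with d v ℕ.≟ 0
      ... | yes q = ℕ.≤-reflexive (trans (cong (k ℕ.*_) q) (trans (ℕ.*-zeroʳ k) (cong (ℕ._* (k ℕ.* class-shift v ℕ.+ class-cut v)) (sym q))))
      ... | no q = ℕ.≤-trans (ℕ.≤-reflexive (ℕ.*-comm k (d v))) (ℕ.*-monoʳ-≤ (d v) (class-bound v q))

      factor : ∀ {a b} → a ℕ.* b ≢ 0 → a ≢ 0 × b ≢ 0
      factor {a} {b} q = (λ r → q (cong (ℕ._* b) r)) , (λ r → q (trans (cong (a ℕ.*_) r) (ℕ.*-zeroʳ a)))

      bit-≢0 : ∀ {b} → bit b ≢ 0 → b ≡ true
      bit-≢0 {false} q = contradiction refl q
      bit-≢0 {true} q = refl

      -- By `K-disjoint`, at most one deviating class contains `u`, and classes contain near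
      -- vertices only.
      shift-share : ∀ u → sumℕ (λ v → d v ℕ.* bit (K v u)) ℕ.≤ bit (not (far u))
      shift-share u = sum-unique-≤ _ bound λ v v′ q q′ →
        K-disjoint v v′ u (proj₁ (factor q)) (proj₁ (factor q′)) (bit-≢0 (proj₂ (factor {d v} q))) (bit-≢0 (proj₂ (factor {d v′} q′)))
        where
        bound : ∀ v → d v ℕ.* bit (K v u) ℕ.≤ bit (not (far u))
        bound v with K v u in eq
        ... | false = ℕ.≤-trans (ℕ.≤-reflexive (ℕ.*-zeroʳ (d v))) ℕ.z≤n
        ... | true = ℕ.≤-trans (ℕ.≤-reflexive (ℕ.*-identityʳ (d v))) (ℕ.≤-trans (d≤1 v) (ℕ.≤-reflexive (cong (bit ∘ not) (sym (proj₁ (K-sound v u eq))))))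

      -- By `crossing-disjoint`, `e` leaves at most one deviating class, and then `s e` is 1.
      cut-share : ∀ e → sumℕ (λ v → d v ℕ.* bit (cross v e)) ℕ.≤ s e
      cut-share e = sum-unique-≤ _ bound λ v v′ q q′ →
        crossing-disjoint v v′ e (proj₁ (factor q)) (proj₁ (factor q′)) (bit-≢0 (proj₂ (factor {d v} q))) (bit-≢0 (proj₂ (factor {d v′} q′)))
        where
        bound : ∀ v → d v ℕ.* bit (cross v e) ℕ.≤ s e
        bound v with cross v e in eq
        ... | false = ℕ.≤-trans (ℕ.≤-reflexive (ℕ.*-zeroʳ (d v))) ℕ.z≤n
        ... | true = ℕ.≤-trans (ℕ.≤-reflexive (ℕ.*-identityʳ (d v))) (ℕ.≤-trans (d≤1 v) (ℕ.≤-reflexive (sym (crossing-s v e eq))))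

      regroup : ∀ {r} (P : Fin n → Fin r → Bool) (w : Fin r → ℕ) →
        sumℕ (λ v → d v ℕ.* sumℕ (λ i → bit (P v i) ℕ.* w i)) ≡ sumℕ (λ i → w i ℕ.* sumℕ (λ v → d v ℕ.* bit (P v i)))
      regroup P w = begin
        sumℕ (λ v → d v ℕ.* sumℕ (λ i → bit (P v i) ℕ.* w i)) ≡⟨ Σℕ.sum-cong-≗ (λ v → Σℕ.*-distribˡ-sum (d v) (λ i → bit (P v i) ℕ.* w i)) ⟩
        sumℕ (λ v → sumℕ (λ i → d v ℕ.* (bit (P v i) ℕ.* w i))) ≡⟨ Σℕ.∑-comm (λ v i → d v ℕ.* (bit (P v i) ℕ.* w i)) ⟩
        sumℕ (λ i → sumℕ (λ v → d v ℕ.* (bit (P v i) ℕ.* w i)))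
          ≡⟨ Σℕ.sum-cong-≗ (λ i → trans (Σℕ.sum-cong-≗ (λ v → rotate (d v) (bit (P v i)) (w i))) (sym (Σℕ.*-distribˡ-sum (w i) (λ v → d v ℕ.* bit (P v i))))) ⟩
        sumℕ (λ i → w i ℕ.* sumℕ (λ v → d v ℕ.* bit (P v i))) ∎
        where
        open ≡-Reasoning
        rotate : ∀ a b c → a ℕ.* (b ℕ.* c) ≡ c ℕ.* (a ℕ.* b)
        rotate = ℕ-Solver.solve-∀

      -- `class-bound` is summed over the deviating vertices; the two share lemmas ensure that no
      -- near shift and no edge is counted twice.
      class-total : k ℕ.* N ℕ.≤ k ℕ.* A ℕ.+ W
      class-total = begin
        k ℕ.* N ≡⟨ Σℕ.*-distribˡ-sum k d ⟩
        sumℕ (λ v → k ℕ.* d v) ≤⟨ sumℕ-mono class-bound-* ⟩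
        sumℕ (λ v → d v ℕ.* (k ℕ.* class-shift v ℕ.+ class-cut v)) ≡⟨ Σℕ.sum-cong-≗ (λ v → expand (d v) k (class-shift v) (class-cut v)) ⟩
        sumℕ (λ v → k ℕ.* (d v ℕ.* class-shift v) ℕ.+ d v ℕ.* class-cut v) ≡⟨ Σℕ.∑-distrib-+ (λ v → k ℕ.* (d v ℕ.* class-shift v)) _ ⟩
        sumℕ (λ v → k ℕ.* (d v ℕ.* class-shift v)) ℕ.+ sumℕ (λ v → d v ℕ.* class-cut v)
          ≡⟨ cong₂ ℕ._+_ (trans (sym (Σℕ.*-distribˡ-sum k (λ v → d v ℕ.* class-shift v))) (cong (k ℕ.*_) (regroup K (λ u → ∣ a u ∣)))) (regroup cross (F x)) ⟩
        k ℕ.* sumℕ (λ u → ∣ a u ∣ ℕ.* sumℕ (λ v → d v ℕ.* bit (K v u))) ℕ.+ sumℕ (λ e → F x e ℕ.* sumℕ (λ v → d v ℕ.* bit (cross v e)))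
          ≤⟨ ℕ.+-mono-≤ (ℕ.*-monoʳ-≤ k (sumℕ-mono (λ u → ℕ.≤-trans (ℕ.*-monoʳ-≤ ∣ a u ∣ (shift-share u)) (ℕ.≤-reflexive (ℕ.*-comm ∣ a u ∣ _)))))
                       (sumℕ-mono (λ e → ℕ.*-monoʳ-≤ (F x e) (cut-share e))) ⟩
        k ℕ.* A ℕ.+ W ∎
        where
        open ℕ.≤-Reasoning
        expand : ∀ d k s c → d ℕ.* (k ℕ.* s ℕ.+ c) ≡ k ℕ.* (d ℕ.* s) ℕ.+ d ℕ.* c
        expand = ℕ-Solver.solve-∀

      -- `barrier-bound` and `class-total` enclose `k ℕ.* N`; their bounds differ by exactly
      -- `k ℕ.* opt₀`.
      opt₀≡0 : opt₀ ≡ 0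
      opt₀≡0 with opt₀ ℕ.≟ 0
      ... | yes q = q
      ... | no q = contradiction (begin-strict
        k ℕ.* A ℕ.+ W <⟨ ℕ.+-monoˡ-< W (ℕ.*-monoʳ-< k {{ℕ.>-nonZero (ℕ.m≤n+m 1 (2 ℕ.* p))}} (ℕ.m<n+m A (ℕ.n≢0⇒n>0 q))) ⟩
        k ℕ.* (opt₀ ℕ.+ A) ℕ.+ W ≤⟨ barrier-bound ⟩
        k ℕ.* N ≤⟨ class-total ⟩
        k ℕ.* A ℕ.+ W ∎) (ℕ.<-irrefl refl)
        where open ℕ.≤-Reasoning

  balanced-state : ∃ λ x → ∀ v → δ c₀ x v ≡ + 0
  balanced-state with settled-target c₀ M
  ... | opt₀ , T , settled , x , x-cost with Barrier.least-far T settled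
  -- The state `y`, optimal for the shifted targets, certifies that the minimum is 0; the balanced
  -- state is `x`, which attains it for `c₀`.
  ...   | y , y-opt , y-least = x , λ v → ℤ.∣i∣≡0⇒i≡0 (ℕ.n≤0⇒n≡0 (ℕ.≤-trans (term≤sum (λ v → ∣ δ c₀ x v ∣) v)
            (ℕ.≤-reflexive (trans x-cost (Barrier.AtBarrier.opt₀≡0 T settled y y-opt y-least)))))

-- Edge cuts and components

∨-elim : ∀ {a b} → a ∨ b ≡ true → a ≡ true ⊎ b ≡ true
∨-elim {true} p = inj₁ refl
∨-elim {false} p = inj₂ p

∨-introˡ : ∀ {a b} → a ≡ true → a ∨ b ≡ true
∨-introˡ refl = refl

∨-introʳ : ∀ a {b} → b ≡ true → a ∨ b ≡ true
∨-introʳ a refl = Bool.∨-zeroʳ a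

∧-elim : ∀ {a b} → a ∧ b ≡ true → a ≡ true × b ≡ true
∧-elim {true} p = refl , p

⌊⌋-elim : ∀ {A : Set} {a? : Dec A} → ⌊ a? ⌋ ≡ true → A
⌊⌋-elim {a? = yes a} p = a

⌊⌋-intro : ∀ {A : Set} (a? : Dec A) → A → ⌊ a? ⌋ ≡ true
⌊⌋-intro (yes _) a = refl
⌊⌋-intro (no ¬a) a = contradiction a ¬a

anyFin-elim : ∀ {k} (P : Fin k → Bool) → anyFin P ≡ true → ∃ λ i → P i ≡ true
anyFin-elim {suc k} P p with P zero in eq
... | true = zero , eq
... | false with anyFin-elim (P ∘ suc) p
...   | i , q = suc i , q

anyFin-intro : ∀ {k} (P : Fin k → Bool) i → P i ≡ true → anyFin P ≡ true
anyFin-intro P zero p = cong (_∨ anyFin (P ∘ suc)) p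
anyFin-intro P (suc i) p = ∨-introʳ (P zero) (anyFin-intro (P ∘ suc) i p)

bit≤1 : ∀ b → bit b ℕ.≤ 1
bit≤1 false = ℕ.z≤n
bit≤1 true = ℕ.≤-refl

bit-mono : ∀ {a b} → (a ≡ true → b ≡ true) → bit a ℕ.≤ bit b
bit-mono {false} p = ℕ.z≤n
bit-mono {true} p = ℕ.≤-reflexive (cong bit (sym (p refl)))

count-mono : ∀ {k} {P Q : Fin k → Bool} → (∀ i → P i ≡ true → Q i ≡ true) → count P ℕ.≤ count Q
count-mono {zero} sub = ℕ.z≤n
count-mono {suc k} {P} {Q} sub = ℕ.+-mono-≤ (bit-mono {P zero} (sub zero)) (count-mono (sub ∘ suc))

count-strict : ∀ {k} {P Q : Fin k → Bool} → (∀ i → P i ≡ true → Q i ≡ true) →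
  ∀ i → P i ≡ false → Q i ≡ true → count P ℕ.< count Q
count-strict {suc k} {P} {Q} sub zero p q = ℕ.+-mono-<-≤ (subst₂ (λ a b → bit a ℕ.< bit b) (sym p) (sym q) ℕ.≤-refl) (count-mono (sub ∘ suc))
count-strict {suc k} {P} {Q} sub (suc i) p q = ℕ.+-mono-≤-< (bit-mono {P zero} (sub zero)) (count-strict (sub ∘ suc) i p q)

count≤size : ∀ {k} (P : Fin k → Bool) → count P ℕ.≤ k
count≤size {zero} P = ℕ.z≤n
count≤size {suc k} P = ℕ.+-mono-≤ (bit≤1 (P zero)) (count≤size (P ∘ suc))

count-positive : ∀ {k} (P : Fin k → Bool) i → P i ≡ true → 0 ℕ.< count P
count-positive P zero p = ℕ.<-≤-trans (subst (λ b → 0 ℕ.< bit b) (sym p) ℕ.≤-refl) (ℕ.m≤m+n _ _)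
count-positive P (suc i) p = ℕ.<-≤-trans (count-positive (P ∘ suc) i p) (ℕ.m≤n+m _ (bit (P zero)))

least : ∀ {k} {Q : Fin k → Set} → (∀ i → Dec (Q i)) → ∀ i → Q i → ∃ λ r → Q r × (∀ w → w Fin.< r → ¬ Q w)
least {k} {Q} Q? i q = search (toℕ i) i q ℕ.≤-refl
  where
  search : ∀ d i → Q i → toℕ i ℕ.≤ d → ∃ λ r → Q r × (∀ w → w Fin.< r → ¬ Q w)
  search d i q b with any? (λ w → w Fin.<? i ×-dec Q? w)
  ... | no none = i , q , λ w w<i q′ → none (w , w<i , q′)
  search zero i q b | yes (w , w<i , q′) = contradiction (ℕ.<-≤-trans w<i b) λ ()
  search (suc d) i q b | yes (w , w<i , q′) = search d w q′ (ℕ.≤-pred (ℕ.<-≤-trans w<i b))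

module Connectivity (G : Graph) where

  V E : Set
  V = Fin (n G)
  E = Fin (m G)

  src dst : E → V
  src e = proj₁ (ends G e)
  dst e = proj₂ (ends G e)

  data Path (P : E → Bool) (u : V) : V → Set where
    here     : Path P u u
    forward  : ∀ e → P e ≡ true → Path P u (src e) → Path P u (dst e)
    backward : ∀ e → P e ≡ true → Path P u (dst e) → Path P u (src e)

  path-trans : ∀ {P u v w} → Path P u v → Path P v w → Path P u w
  path-trans π here = π
  path-trans π (forward e p ρ) = forward e p (path-trans π ρ)
  path-trans π (backward e p ρ) = backward e p (path-trans π ρ)

  path-sym : ∀ {P u v} → Path P u v → Path P v u
  path-sym here = here
  path-sym (forward e p π) = path-trans (backward e p here) (path-sym π)
  path-sym (backward e p π) = path-trans (forward e p here) (path-sym π)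

  path-mono : ∀ {P Q u v} → (∀ e → P e ≡ true → Q e ≡ true) → Path P u v → Path Q u v
  path-mono sub here = here
  path-mono sub (forward e p π) = forward e (sub e p) (path-mono sub π)
  path-mono sub (backward e p π) = backward e (sub e p) (path-mono sub π)

  module _ (P : E → Bool) (u : V) where

    R : ℕ → V → Bool
    R k = reachWithin G P k u

    reach-cases : ∀ k v → R (suc k) v ≡ true → R k v ≡ true ⊎
      ∃ λ e → P e ≡ true × ((R k (src e) ≡ true × dst e ≡ v) ⊎ (R k (dst e) ≡ true × src e ≡ v))
    reach-cases k v p with ∨-elim {R k v} p
    ... | inj₁ q = inj₁ q
    ... | inj₂ q with anyFin-elim _ q
    ...   | e , r with ∧-elim {P e} r
    ...     | present , r′ with ∨-elim {R k (src e) ∧ (dst e == v)} r′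
    ...       | inj₁ s with ∧-elim {R k (src e)} s
    ...         | s₁ , s₂ = inj₂ (e , present , inj₁ (s₁ , ⌊⌋-elim s₂))
    reach-cases k v p | inj₂ q | e , r | present , r′ | inj₂ s with ∧-elim {R k (dst e)} s
    ...         | s₁ , s₂ = inj₂ (e , present , inj₂ (s₁ , ⌊⌋-elim s₂))

    reach-keep : ∀ k v → R k v ≡ true → R (suc k) v ≡ true
    reach-keep k v p = ∨-introˡ p

    reach-forward : ∀ k e → P e ≡ true → R k (src e) ≡ true → R (suc k) (dst e) ≡ true
    reach-forward k e p q = ∨-introʳ (R k (dst e)) (anyFin-intro _ e
      (cong₂ _∧_ p (cong₂ _∨_ (cong₂ _∧_ q (⌊⌋-intro (dst e ≟ dst e) refl)) refl)))

    reach-backward : ∀ k e → P e ≡ true → R k (dst e) ≡ true → R (suc k) (src e) ≡ true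
    reach-backward k e p q = ∨-introʳ (R k (src e)) (anyFin-intro _ e
      (cong₂ _∧_ p (∨-introʳ (R k (src e) ∧ (dst e == src e)) (cong₂ _∧_ q (⌊⌋-intro (src e ≟ src e) refl)))))

    Saturated : ℕ → Set
    Saturated k = ∀ v → R (suc k) v ≡ true → R k v ≡ true

    saturated-suc : ∀ k → Saturated k → Saturated (suc k)
    saturated-suc k sat v p with reach-cases (suc k) v p
    ... | inj₁ q = q
    ... | inj₂ (e , present , inj₁ (q , refl)) = reach-forward k e present (sat _ q)
    ... | inj₂ (e , present , inj₂ (q , refl)) = reach-backward k e present (sat _ q)

    -- Until it stabilises, the reached set gains a vertex in each round. At `n G` rounds it would
    -- otherwise exceed the vertex set.
    saturated-or-large : ∀ k → Saturated k ⊎ k ℕ.< count (R k)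
    saturated-or-large zero = inj₂ (count-positive (R 0) u (⌊⌋-intro (u ≟ u) refl))
    saturated-or-large (suc k) with saturated-or-large k
    ... | inj₁ sat = inj₁ (saturated-suc k sat)
    ... | inj₂ large with any? (λ v → (R (suc k) v Bool.≟ true) ×-dec (R k v Bool.≟ false))
    ...   | yes (v , p , q) = inj₂ (ℕ.≤-<-trans large (count-strict (reach-keep k) v q p))
    ...   | no none = inj₁ (saturated-suc k λ v p → Bool.¬-not λ q → none (v , p , q))

    saturated : Saturated (n G)
    saturated with saturated-or-large (n G)
    ... | inj₁ sat = sat
    ... | inj₂ large = contradiction (count≤size (R (n G))) (ℕ.<⇒≱ large)

    reach⇒path : ∀ k {v} → R k v ≡ true → Path P u v
    reach⇒path zero p with refl ← ⌊⌋-elim {a? = u ≟ _} p = here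
    reach⇒path (suc k) {v} p with reach-cases k v p
    ... | inj₁ q = reach⇒path k q
    ... | inj₂ (e , present , inj₁ (q , refl)) = forward e present (reach⇒path k q)
    ... | inj₂ (e , present , inj₂ (q , refl)) = backward e present (reach⇒path k q)

    reach-start : ∀ k → R k u ≡ true
    reach-start zero = ⌊⌋-intro (u ≟ u) refl
    reach-start (suc k) = reach-keep k u (reach-start k)

    path⇒connected : ∀ {v} → Path P u v → connected G P u v ≡ true
    path⇒connected here = reach-start (n G)
    path⇒connected (forward e p π) = saturated _ (reach-forward (n G) e p (path⇒connected π))
    path⇒connected (backward e p π) = saturated _ (reach-backward (n G) e p (path⇒connected π))

  connected⇒path : ∀ P u {v} → connected G P u v ≡ true → Path P u v
  connected⇒path P u p = reach⇒path P u (n G) p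

  -- This is the predicate counted by `components`.
  leader : (E → Bool) → V → Bool
  leader P v = not (anyFin (λ w → (w <ᵇ v) ∧ connected G P w v))

  leader-elim : ∀ P {v w} → leader P v ≡ true → w Fin.< v → ¬ Path P w v
  leader-elim P {v} {w} p w<v π = contradiction
    (trans (sym p) (cong not (anyFin-intro (λ w → (w <ᵇ v) ∧ connected G P w v) w
      (cong₂ _∧_ (⌊⌋-intro (w Fin.<? v) w<v) (path⇒connected P w π))))) λ ()

  leader-intro : ∀ P v → (∀ w → w Fin.< v → ¬ Path P w v) → leader P v ≡ true
  leader-intro P v none with anyFin (λ w → (w <ᵇ v) ∧ connected G P w v) in eq
  ... | false = refl
  ... | true with anyFin-elim _ eq
  ...   | w , r with ∧-elim {w <ᵇ v} r
  ...     | w<v , q = contradiction (connected⇒path P w q) (none w (⌊⌋-elim w<v))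

  leader-of : ∀ P a → ∃ λ r → leader P r ≡ true × Path P r a
  leader-of P a with least (λ w → connected G P w a Bool.≟ true) a (path⇒connected P a here)
  ... | r , p , smallest = r , leader-intro P r (λ w w<r π → smallest w w<r (path⇒connected P w (path-trans π r⇝a))) , r⇝a
    where r⇝a = connected⇒path P r p

  cut : (V → Bool) → E → Bool
  cut K e = K (src e) xor K (dst e)

  cut-path : ∀ K {u v} → Path (not ∘ cut K) u v → K u ≡ K v
  cut-path K here = refl
  cut-path K (forward e p π) = trans (cut-path K π) (agree (K (src e)) (K (dst e)) p)
    where agree : ∀ a b → not (a xor b) ≡ true → a ≡ b
          agree false false p = refl
          agree true true p = refl
  cut-path K (backward e p π) = trans (cut-path K π) (agree (K (src e)) (K (dst e)) p)
    where agree : ∀ a b → not (a xor b) ≡ true → b ≡ a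
          agree false false p = refl
          agree true true p = refl

  -- Leaders survive the deletion of edges. The ends of `e` have different leaders after the
  -- deletion, as no path avoiding the cut leaves `K`; in `G` these are connected, so the larger one
  -- is a new leader.
  cut-increases-components : ∀ K e → cut K e ≡ true → components G (allEdges G) ℕ.< numComponentsMinus G (cut K)
  cut-increases-components K e crossing with leader-of (not ∘ cut K) (src e) | leader-of (not ∘ cut K) (dst e)
  ... | r , r-leads , r⇝src | s , s-leads , s⇝dst = separate (Fin.<-cmp r s)
    where
    keep : ∀ {u v} → Path (not ∘ cut K) u v → Path (allEdges G) u v
    keep = path-mono (λ _ _ → refl)
    r⇝s : Path (allEdges G) r s
    r⇝s = path-trans (forward e refl (keep r⇝src)) (path-sym (keep s⇝dst))
    fewer : ∀ v → leader (allEdges G) v ≡ true → leader (not ∘ cut K) v ≡ true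
    fewer v p = leader-intro _ v (λ w w<v π → leader-elim _ p w<v (keep π))
    demoted : ∀ {v w} → w Fin.< v → Path (allEdges G) w v → leader (allEdges G) v ≡ false
    demoted w<v π = Bool.¬-not λ p → leader-elim _ p w<v π
    separate : _ → components G (allEdges G) ℕ.< numComponentsMinus G (cut K)
    separate (tri< r<s _ _) = count-strict fewer s (demoted r<s r⇝s) s-leads
    separate (tri> _ _ s<r) = count-strict fewer r (demoted s<r (path-sym r⇝s)) r-leads
    separate (tri≈ _ refl _) = contradiction (trans (sym crossing) (same (K (src e)) (K (dst e)) (trans (sym (cut-path K r⇝src)) (cut-path K s⇝dst)))) λ ()
      where same : ∀ a b → a ≡ b → a xor b ≡ false
            same a .a refl = Bool.xor-same a

-- From modulo flows to integer flows

count-true : ∀ {k} (P : Fin k → Bool) → count P ≢ 0 → ∃ λ i → P i ≡ true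
count-true {zero} P q = contradiction refl q
count-true {suc k} P q with P zero in eq
... | true = zero , eq
... | false with count-true (P ∘ suc) q
...   | i , r = suc i , r

signed-magnitude : ∀ z → signℤ (ℤ.sign z) ℤ.* + ∣ z ∣ ≡ z
signed-magnitude (+ k) = ℤ.*-identityˡ (+ k)
signed-magnitude -[1+ k ] = cong -[1+_] (ℕ.+-identityʳ k)

signed-* : ∀ s t b → signℤ s ℤ.* + b ℤ.* signℤ t ≡ + b ℤ.* signℤ (s Sign.* t)
signed-* s t b = trans (rearrange (signℤ s) (+ b) (signℤ t)) (cong (ℤ._*_ (+ b)) (signedBit-* true s t))
  where rearrange : ∀ s b t → s ℤ.* b ℤ.* t ≡ b ℤ.* (s ℤ.* t)
        rearrange = solve-∀

opposite-* : ∀ s t → opposite s Sign.* t ≡ opposite (s Sign.* t)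
opposite-* Sign.+ Sign.+ = refl
opposite-* Sign.+ Sign.- = refl
opposite-* Sign.- Sign.+ = refl
opposite-* Sign.- Sign.- = refl

∣signed∣ : ∀ s k → ∣ signℤ s ℤ.* + k ∣ ≡ k
∣signed∣ Sign.+ k = cong ∣_∣ (ℤ.*-identityˡ (+ k))
∣signed∣ Sign.- k = trans (cong ∣_∣ (ℤ.-1*i≡-i (+ k))) (ℤ.∣-i∣≡∣i∣ (+ k))

module _ (p : ℕ) (1≤p : 1 ℕ.≤ p) (G : Graph) (τ : Orientation G) (odd : OddEdgeConnected G (2 ℕ.* p ℕ.+ 1)) where

  -- A single crossing edge would be an odd 1-edge cut, which is forbidden because `1≤p` gives 1 + 2
  -- ≤ 2p + 1.
  bridgeless : ∀ (K : Fin (n G) → Bool) → count (Connectivity.cut G K) ≢ 1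
  bridgeless K one with count-true (Connectivity.cut G K) (λ q → contradiction (trans (sym q) one) λ ())
  ... | e , crossing = odd 1 (ℕ.+-monoˡ-≤ 1 (ℕ.*-monoʳ-≤ 2 1≤p)) (Connectivity.cut G K)
    (one , (0 , refl) , Connectivity.cut-increases-components G K e crossing)

  module Lift (f₀ : Fin (m G) → ℤ) (range : ∀ e → p ℕ.≤ ∣ f₀ e ∣ × ∣ f₀ e ∣ ℕ.≤ (2 ℕ.* p ℕ.+ 1) ℕ.∸ p)
    (mod : ∀ v → ∃ λ q → boundary G τ f₀ v ≡ q ℤ.* + (2 ℕ.* p ℕ.+ 1)) where

    k : ℕ
    k = 2 ℕ.* p ℕ.+ 1

    p≤k : p ℕ.≤ k
    p≤k = ℕ.≤-trans (ℕ.m≤n*m p 2) (ℕ.m≤m+n _ 1)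

    end : Fin (m G) → Bool → Fin (n G)
    end e h = endOf G (e , h)

    out : Fin (m G) → Bool → Sign
    out e h = ℤ.sign (f₀ e) Sign.* τ (e , h)

    open Bidirected end out

    F : State → Fin (m G) → ℕ
    F x e = if lookup x e then k ℕ.∸ ∣ f₀ e ∣ else ∣ f₀ e ∣

    -- On a flipped edge this is `f₀ e` minus `k` times its sign.
    f : State → Fin (m G) → ℤ
    f x e = signℤ (if lookup x e then opposite (ℤ.sign (f₀ e)) else ℤ.sign (f₀ e)) ℤ.* + F x e

    -- The interval from `p` to `k ℕ.∸ p` is symmetric under subtraction from `k`.
    F-range : ∀ x e → p ℕ.≤ F x e × F x e ℕ.≤ k ℕ.∸ p
    F-range x e with lookup x e
    ... | false = range e
    ... | true = ℕ.≤-trans (ℕ.≤-reflexive (sym (ℕ.m∸[m∸n]≡n p≤k))) (ℕ.∸-monoʳ-≤ k (proj₂ (range e))) ,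
                 ℕ.∸-monoʳ-≤ k (proj₁ (range e))

    f-sign : ∀ x e h → f x e ℤ.* signℤ (τ (e , h)) ≡ + F x e ℤ.* signℤ (cur x e h)
    f-sign x e h with lookup x e
    ... | false = signed-* (ℤ.sign (f₀ e)) (τ (e , h)) ∣ f₀ e ∣
    ... | true = trans (signed-* (opposite (ℤ.sign (f₀ e))) (τ (e , h)) (k ℕ.∸ ∣ f₀ e ∣))
        (cong (λ s → + (k ℕ.∸ ∣ f₀ e ∣) ℤ.* signℤ s) (opposite-* (ℤ.sign (f₀ e)) (τ (e , h))))

    inc : State → Fin (m G) → Fin (n G) → ℤ
    inc x e v = single (end e false) (cur x e false) v ℤ.+ single (end e true) (cur x e true) v

    -- Stated for a general `g`, since it is applied both to `f₀` and to the final flow.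
    boundary-inc : ∀ (g : Fin (m G) → ℤ) (b : Fin (m G) → ℕ) (s : Fin (m G) → Bool → Sign) →
      (∀ e h → g e ℤ.* signℤ (τ (e , h)) ≡ + b e ℤ.* signℤ (s e h)) → ∀ v →
      boundary G τ g v ≡ sumℤ (λ e → + b e ℤ.* (single (end e false) (s e false) v ℤ.+ single (end e true) (s e true) v))
    boundary-inc g b s agree v = trans (ΣFin≡sumℤ {m G} _) (Σℤ.sum-cong-≗ λ e →
      trans (cong₂ ℤ._+_ (half e false) (half e true)) (sym (ℤ.*-distribˡ-+ (+ b e) _ _)))
      where
      half : ∀ e h → (if end e h == v then g e ℤ.* signℤ (τ (e , h)) else + 0) ≡ + b e ℤ.* single (end e h) (s e h) v
      half e h with end e h ≟ v
      ... | yes _ = agree e h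
      ... | no _ = sym (ℤ.*-zeroʳ (+ b e))

    c₀ : Fin (n G) → ℤ
    c₀ v = proj₁ (mod v)

    balance : ∀ x v → + k ℤ.* δ c₀ x v ≡ sumℤ (λ e → + F x e ℤ.* inc x e v)
    balance x v = begin
      + k ℤ.* (c₀ v ℤ.+ sumℤ (λ e → κ (lookup x e) e v)) ≡⟨ ℤ.*-distribˡ-+ (+ k) (c₀ v) _ ⟩
      + k ℤ.* c₀ v ℤ.+ + k ℤ.* sumℤ (λ e → κ (lookup x e) e v)
        ≡⟨ cong₂ ℤ._+_ (trans (ℤ.*-comm (+ k) (c₀ v)) (sym (proj₂ (mod v)))) (Σℤ.*-distribˡ-sum (+ k) (λ e → κ (lookup x e) e v)) ⟩
      boundary G τ f₀ v ℤ.+ sumℤ (λ e → + k ℤ.* κ (lookup x e) e v)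
        ≡⟨ cong (ℤ._+ sumℤ (λ e → + k ℤ.* κ (lookup x e) e v)) (boundary-inc f₀ (λ e → ∣ f₀ e ∣) out start v) ⟩
      sumℤ (λ e → + ∣ f₀ e ∣ ℤ.* inc₀ e) ℤ.+ sumℤ (λ e → + k ℤ.* κ (lookup x e) e v) ≡⟨ Σℤ.∑-distrib-+ (λ e → + ∣ f₀ e ∣ ℤ.* inc₀ e) _ ⟨
      sumℤ (λ e → + ∣ f₀ e ∣ ℤ.* inc₀ e ℤ.+ + k ℤ.* κ (lookup x e) e v) ≡⟨ Σℤ.sum-cong-≗ edge ⟩
      sumℤ (λ e → + F x e ℤ.* inc x e v) ∎
      where
      open ≡-Reasoning
      inc₀ : Fin (m G) → ℤ
      inc₀ e = single (end e false) (out e false) v ℤ.+ single (end e true) (out e true) v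
      start : ∀ e h → f₀ e ℤ.* signℤ (τ (e , h)) ≡ + ∣ f₀ e ∣ ℤ.* signℤ (out e h)
      start e h = trans (cong (ℤ._* signℤ (τ (e , h))) (sym (signed-magnitude (f₀ e)))) (signed-* (ℤ.sign (f₀ e)) (τ (e , h)) ∣ f₀ e ∣)
      edge : ∀ e → + ∣ f₀ e ∣ ℤ.* inc₀ e ℤ.+ + k ℤ.* κ (lookup x e) e v ≡ + F x e ℤ.* inc x e v
      edge e with lookup x e
      ... | false = trans (cong (ℤ._+_ (+ ∣ f₀ e ∣ ℤ.* inc₀ e)) (ℤ.*-zeroʳ (+ k))) (ℤ.+-identityʳ _)
      ... | true = begin
        + ∣ f₀ e ∣ ℤ.* (s₀ ℤ.+ s₁) ℤ.+ + k ℤ.* (single (end e false) (opposite (out e false)) v ℤ.+ single (end e true) (opposite (out e true)) v)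
          ≡⟨ cong₂ (λ i j → + ∣ f₀ e ∣ ℤ.* (s₀ ℤ.+ s₁) ℤ.+ + k ℤ.* (i ℤ.+ j)) (single-opposite (end e false) _ v) (single-opposite (end e true) _ v) ⟩
        + ∣ f₀ e ∣ ℤ.* (s₀ ℤ.+ s₁) ℤ.+ + k ℤ.* (ℤ.- s₀ ℤ.+ ℤ.- s₁) ≡⟨ cong (λ i → + ∣ f₀ e ∣ ℤ.* (s₀ ℤ.+ s₁) ℤ.+ i ℤ.* (ℤ.- s₀ ℤ.+ ℤ.- s₁)) k-split ⟩
        + ∣ f₀ e ∣ ℤ.* (s₀ ℤ.+ s₁) ℤ.+ (+ (k ℕ.∸ ∣ f₀ e ∣) ℤ.+ + ∣ f₀ e ∣) ℤ.* (ℤ.- s₀ ℤ.+ ℤ.- s₁) ≡⟨ cancel (+ ∣ f₀ e ∣) (+ (k ℕ.∸ ∣ f₀ e ∣)) s₀ s₁ ⟩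
        + (k ℕ.∸ ∣ f₀ e ∣) ℤ.* (ℤ.- s₀ ℤ.+ ℤ.- s₁)
          ≡⟨ cong₂ (λ i j → + (k ℕ.∸ ∣ f₀ e ∣) ℤ.* (i ℤ.+ j)) (single-opposite (end e false) _ v) (single-opposite (end e true) _ v) ⟨
        + (k ℕ.∸ ∣ f₀ e ∣) ℤ.* (single (end e false) (opposite (out e false)) v ℤ.+ single (end e true) (opposite (out e true)) v) ∎
        where
        s₀ = single (end e false) (out e false) v
        s₁ = single (end e true) (out e true) v
        -- The truncated subtraction is exact because `∣ f₀ e ∣` is at most `k`.
        k-split : + k ≡ + (k ℕ.∸ ∣ f₀ e ∣) ℤ.+ + ∣ f₀ e ∣
        k-split = cong +_ (sym (ℕ.m∸n+n≡m (ℕ.≤-trans (proj₂ (range e)) (ℕ.m∸n≤m k p))))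
        cancel : ∀ a b s t → a ℤ.* (s ℤ.+ t) ℤ.+ (b ℤ.+ a) ℤ.* (ℤ.- s ℤ.+ ℤ.- t) ≡ b ℤ.* (ℤ.- s ℤ.+ ℤ.- t)
        cancel = solve-∀

    integer-flow : ∃ λ g → IntegerCircularFlow G τ k p g
    integer-flow with Counting.balanced-state end out c₀ p F (λ x e → proj₁ (F-range x e)) balance bridgeless
    ... | x , balanced = f x , (λ e → subst (λ i → p ℕ.≤ i × i ℕ.≤ k ℕ.∸ p)
        (sym (∣signed∣ (if lookup x e then opposite (ℤ.sign (f₀ e)) else ℤ.sign (f₀ e)) (F x e))) (F-range x e)) ,
      λ v → trans (boundary-inc (f x) (F x) (cur x) (f-sign x) v)
        (trans (sym (balance x v)) (trans (cong (ℤ._*_ (+ k)) (balanced v)) (ℤ.*-zeroʳ (+ k))))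

theorem1p8 : (p : ℕ) → 1 ≤ p → (G : Graph) → (σ : Signature G) → (τ : Orientation G) →
    IsOrientation G σ τ → OddEdgeConnected G (2 * p + 1) →
    (AdmitsModuloFlow G σ τ p ⇔ AdmitsIntegerFlow G σ τ p)
theorem1p8 p 1≤p G σ τ _ odd = mk⇔ lift reduce
  where
  k = 2 ℕ.* p ℕ.+ 1
  lift : AdmitsModuloFlow G σ τ p → AdmitsIntegerFlow G σ τ p
  lift (f , range , mod) = Lift.integer-flow p 1≤p G τ odd f range λ v → quotient (mod v)
    where
    quotient : ∀ {z} → k ℕ.∣ ∣ z ∣ → ∃ λ q → z ≡ q ℤ.* + k
    -- Divisibility of absolute values is converted to a signed quotient, the initial imbalance.
    quotient {z} d with ∣ᵤ⇒∣ {+ k} {z} d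
    ... | divides q eq = q , eq
  reduce : AdmitsIntegerFlow G σ τ p → AdmitsModuloFlow G σ τ p
  -- The same `f` serves, because `k` divides 0.
  reduce (f , range , zero-boundary) = f , range , λ v → subst (λ z → k ℕ.∣ ∣ z ∣) (sym (zero-boundary v)) (k ℕ.∣0)
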